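{- Let $m\ge 2$ and $n\ge 1$ be integers. Let $\operatorname{TSRP}(m,n,2)$ be the set of primitive TSR matrices of order $n$ over $\mathbb{F}_{2^m}$ and $\Psi_P(\operatorname{TSRP}(m,n,2))=\{\det(XI_{mn}-T): T\in\operatorname{TSRP}(m,n,2)\}$. Then $$\left|\operatorname{TSRP}(m,n,2)\right| = \left|\Psi_P\left(\operatorname{TSRP}(m,n,2)\right)\right| \prod_{i=1}^{m-1}(2^m-2^i).$$
   Context: A polynomial of degree $d$ over a finite field $\mathbb{F}_Q$ is primitive if it is monic and irreducible and one (equivalently every) root generates $\mathbb{F}_{Q^d}^*$. A TSR matrix of order $n$ over $\mathbb{F}_{2^m}$ is an $mn\times mn$ block matrix over $\mathbb{F}_2$ with $m\times m$ blocks of the form $$T=\begin{pmatrix} \mathbf{0} & \mathbf{0} & \cdots & \mathbf{0} & c_0A\\ I_m & \mathbf{0} & \cdots & \mathbf{0} & c_1A\\ \mathbf{0} & I_m & \cdots & \mathbf{0} & c_2A\\ \vdots & & \ddots & & \vdots\\ \mathbf{0} & \mathbf{0} & \cdots & I_m & c_{n-1}A\end{pmatrix},$$ with $c_0,\dots,c_{n-1}\in\mathbb{F}_2$ and $A\in M_m(\mathbb{F}_2)$. It is primitive if $\det(XI_{mn}-T)\in\mathbb{F}_2[X]$ is a primitive polynomial of degree $mn$ over $\mathbb{F}_2$; $\operatorname{TSRP}(m,n,2)$ is the set of all such primitive matrices. -}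

module Defs where

open import Data.Bool using (Bool; true; false; _∧_; _xor_; if_then_else_)
open import Data.Nat using (ℕ; zero; suc; _+_; _*_; _∸_; _^_; _≤_; _<_)
open import Data.Fin using (Fin; remQuot; toℕ)
open import Data.Fin.Properties using () renaming (_≟_ to _≟ᶠ_)
open import Data.List using (List; []; _∷_; _∷ʳ_; length; replicate; map; drop; upTo)
open import Data.Nat.ListAction using (product)
open import Data.List.Membership.Propositional using (_∈_)
open import Data.List.Relation.Unary.Unique.Propositional using (Unique)
open import Data.Vec using (Vec; []; _∷_; tabulate; lookup; removeAt)
open import Data.Product using (Σ; ∃; _×_; _,_; proj₁; proj₂)
open import Data.Sum using (_⊎_)
open import Relation.Binary.PropositionalEquality using (_≡_; _≢_)
open import Relation.Nullary using (¬_; does)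
open import Function.Bundles using (_⇔_)

-- F₂ = Bool (false = 0, true = 1, _xor_ = +, _∧_ = ·)

-- Polynomials over F₂: coefficient lists, lowest degree first.
-- Canonical form: no trailing zero coefficients (the zero polynomial is []).

Poly : Set
Poly = List Bool

normalize : Poly → Poly
normalize [] = []
normalize (a ∷ p) with normalize p
... | [] = if a then true ∷ [] else []
... | q@(_ ∷ _) = a ∷ q

addRaw : Poly → Poly → Poly
addRaw [] q = q
addRaw (a ∷ p) [] = a ∷ p
addRaw (a ∷ p) (b ∷ q) = (a xor b) ∷ addRaw p q

scaleRaw : Bool → Poly → Poly
scaleRaw a = map (a ∧_)

mulRaw : Poly → Poly → Poly
mulRaw [] q = []
mulRaw (a ∷ p) q = addRaw (scaleRaw a q) (false ∷ mulRaw p q)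

_⊕_ : Poly → Poly → Poly
p ⊕ q = normalize (addRaw p q)

_⊗_ : Poly → Poly → Poly
p ⊗ q = normalize (mulRaw p q)

infixl 6 _⊕_
infixl 7 _⊗_

one : Poly
one = true ∷ []

Xpow : ℕ → Poly
Xpow k = replicate k false ∷ʳ true

-- degree (the zero polynomial is given degree 0; it never matters below)
deg : Poly → ℕ
deg p = length (normalize p) ∸ 1

_∣ₚ_ : Poly → Poly → Set
f ∣ₚ g = ∃ λ q → q ⊗ f ≡ normalize g

Monic : Poly → Set
Monic f = ∃ λ g → f ≡ g ∷ʳ true

Irreducible : Poly → Set
Irreducible f = (1 ≤ deg f) × (∀ g h → g ⊗ h ≡ f → deg g ≡ 0 ⊎ deg h ≡ 0)

-- For f irreducible of degree d, F₂[X]/(f) is the field F_{2^d}, with root of f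
-- the class of X; its nonzero elements are represented by the canonical
-- nonzero polynomials r with deg r < d. "The root generates F_{2^d}^*":
-- every nonzero element is a power X^k, i.e. f ∣ X^k − r (= X^k + r in char 2).
RootGenerates : Poly → Set
RootGenerates f =
  ∀ r → normalize r ≡ r → r ≢ [] → deg r < deg f → ∃ λ k → f ∣ₚ (Xpow k ⊕ r)

Primitive : ℕ → Poly → Set
Primitive d f = Monic f × deg f ≡ d × Irreducible f × RootGenerates f

Mat : Set → ℕ → Set
Mat A k = Vec (Vec A k) k

-- determinant over F₂[X] by Laplace expansion along the first row.
-- In characteristic 2 all cofactor signs are +1, so this is the determinant.
sumFin : ∀ {k} → (Fin k → Poly) → Poly
sumFin {zero} f = []
sumFin {suc k} f = f Fin.zero ⊕ sumFin (λ i → f (Fin.suc i))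
  where import Data.Fin as Fin

det : ∀ {k} → Mat Poly k → Poly
det {zero} [] = one
det {suc k} (row ∷ rows) =
  sumFin (λ j → lookup row j ⊗ det (Data.Vec.map (λ r → removeAt r j) rows))
  where import Data.Vec

δ : ∀ {k} → Fin k → Fin k → Bool
δ i j = does (i ≟ᶠ j)

-- the characteristic polynomial det(X·I − T) ∈ F₂[X]   (−1 = 1 in F₂)
charPoly : ∀ {k} → Mat Bool k → Poly
charPoly {k} T =
  det (tabulate λ i → tabulate λ j →
         normalize (lookup (lookup T i) j ∷ δ i j ∷ []))

-- TSR matrices of order n over F_{2^m}: (nm) × (nm) matrices over F₂ made of
-- n × n blocks of size m × m. Index i : Fin (n * m) is block (i / m), offset (i % m).

tsr : (m n : ℕ) → Vec Bool n → Mat Bool m → Mat Bool (n * m)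
tsr m n c A = tabulate λ i → tabulate λ j → entry (remQuot m i) (remQuot m j)
  where
  entry : Fin n × Fin m → Fin n × Fin m → Bool
  entry (bi , ri) (bj , rj) =
    if does (Data.Nat._≟_ (suc (toℕ bj)) n)
    then lookup c bi ∧ lookup (lookup A ri) rj
    else (if does (Data.Nat._≟_ (toℕ bi) (suc (toℕ bj)))
          then δ ri rj
          else false)
    where import Data.Nat

IsTSR : (m n : ℕ) → Mat Bool (n * m) → Set
IsTSR m n T = ∃ λ (c : Vec Bool n) → ∃ λ (A : Mat Bool m) → T ≡ tsr m n c A

TSRP : (m n : ℕ) → Mat Bool (n * m) → Set
TSRP m n T = IsTSR m n T × Primitive (n * m) (charPoly T)

PsiTSRP : (m n : ℕ) → Poly → Set
PsiTSRP m n f = ∃ λ (T : Mat Bool (n * m)) → TSRP m n T × charPoly T ≡ f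

HasCard : {A : Set} → (A → Set) → ℕ → Set
HasCard {A} P N = Σ (List A) λ L → Unique L × (∀ x → (x ∈ L) ⇔ P x) × length L ≡ N

prodGL : ℕ → ℕ
prodGL m = product (map (λ i → 2 ^ m ∸ 2 ^ i) (drop 1 (upTo m)))

{-# OPTIONS --safe #-}
module Submission where

-- Write K = F₂[X]/(f) with root θ, and let T be the TSR matrix of (c , A) with characteristic
-- polynomial the primitive f. With g = Σ cᵢ Xⁱ, the first block s(v) of a vector satisfies
-- s(Tⁿ v) = s(g(T) v) A, so γ = θⁿ / g(θ) acts on first blocks as A. Hence γ generates the
-- subfield of order 2ᵐ, over which θ has degree n; comparing θⁿ = γ g(θ) = γ′ g′(θ) for two such
-- matrices gives c = c′ and γ = γ′. The matrices with characteristic polynomial f are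
-- therefore exactly the TSR matrices of (c , B) with h(B) = 0, where h is the characteristic
-- polynomial of A, and these B correspond to the bases e₁, e₁B, …, e₁Bᵐ⁻¹ of F₂ᵐ beginning with e₁.

open import Defs
open import Data.Bool using (Bool; true; false; _∧_; _xor_; if_then_else_)
open import Data.Bool.Properties as Bool
  using (xor-same; xor-assoc; xor-comm; xor-identityʳ; ∧-zeroʳ; ∧-identityʳ)
open import Data.Fin using (Fin; zero; suc; toℕ; fromℕ; fromℕ<; combine; remQuot)
open import Data.Fin.Properties
  using (remQuot-combine; combine-remQuot; combine-injective; toℕ<n; toℕ-fromℕ<; toℕ-fromℕ; toℕ-injective)
  renaming (_≟_ to _≟ᶠ_)
open import Data.List as List using (List; []; _∷_; _∷ʳ_; _++_; length; applyUpTo; filter)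
open import Data.List.Properties as List using (length-++; length-map; length-applyUpTo; map-applyUpTo)
open import Data.List.Membership.Propositional using (_∈_)
open import Data.List.Membership.Propositional.Properties
  using (∈-∃++; ∈-++⁻; ∈-++⁺ˡ; ∈-++⁺ʳ; ∈-map⁻; ∈-filter⁺; ∈-filter⁻; ∈-applyUpTo⁺; ∈-applyUpTo⁻)
open import Data.List.Relation.Binary.Pointwise using (Pointwise; []; _∷_; Pointwise-length)
open import Data.List.Relation.Unary.All as All using (All; []; _∷_)
open import Data.List.Relation.Unary.All.Properties as All using (¬Any⇒All¬)
open import Data.List.Relation.Unary.AllPairs using ([]; _∷_)
open import Data.List.Relation.Unary.Any using (here; there; any?)
open import Data.List.Relation.Unary.Unique.Propositional using (Unique)
import Data.List.Relation.Unary.Unique.Propositional.Properties as Unique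
open import Data.Nat as ℕ using (ℕ; zero; suc; _+_; _*_; _∸_; _^_; _≤_; _<_; z≤n; s≤s)
open import Data.Nat.ListAction using (product)
open import Data.Nat.Properties as ℕ
  using (≤-refl; ≤-reflexive; ≤-trans; ≤-antisym; 1+n≰n; m≤n⇒m≤1+n; +-identityʳ; +-suc; m+n∸m≡n)
open import Data.Product using (∃; _×_; _,_; proj₁; proj₂)
open import Data.Sum as Sum using (_⊎_; inj₁; inj₂)
open import Data.Unit using (⊤; tt)
open import Data.Vec as Vec using (Vec; []; _∷_; head; lookup; tabulate; zipWith; replicate; toList; removeAt)
open import Data.Vec.Properties
  using (≡-dec; zipWith-assoc; zipWith-comm; zipWith-identityˡ; zipWith-identityʳ; length-toList;
         lookup∘tabulate; tabulate∘lookup; tabulate-cong; tabulate-∘; lookup-zipWith; lookup-replicate; lookup-map)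
open import Function using (_∘_; id; mk⇔; Equivalence)
open import Relation.Binary using (DecidableEquality)
open import Relation.Binary.PropositionalEquality
open import Relation.Nullary using (¬_; yes; no; does; contradiction; ¬?)
open import Relation.Nullary.Decidable using (map′; dec-true; dec-false; decidable-stable; _×-dec_)
open import Relation.Unary using (Decidable)

open Equivalence using (to; from)

-- Vector spaces over F₂

-- Degrees over subfields are measured by Frobenius: N is a period of x if squaring N times fixes x.
-- Primitivity gives two facts. Every nonzero element of K is a power of θ, so nonzero elements act
-- injectively; and θ has no positive period below mn, since its powers must exhaust the nonzero
-- elements. As θ is a root of Xⁿ + γ g, a period N of γ forces a period iN of θ with 1 ≤ i ≤ n,
-- hence N ≥ m; the characteristic polynomial of A vanishes at γ and gives a period at most m. For c
-- = c′, the polynomial γ g + γ′ g′ has n coefficients fixed by the m-th power of Frobenius, under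
-- which θ has n distinct conjugates.
--
-- The condition det(XI - T) = f is traded for f(T) = 0. One direction is the Cayley-Hamilton
-- theorem. Conversely, f(T) = 0 makes the space one-dimensional over K, and then only one monic
-- polynomial of degree mn annihilates T.

V : ℕ → Set
V = Vec Bool

infixl 6 _⊞_
infixr 7 _·_

_⊞_ : ∀ {k} → V k → V k → V k
_⊞_ = zipWith _xor_

0ᵥ : ∀ {k} → V k
0ᵥ = replicate _ false

_·_ : ∀ {k} → Bool → V k → V k
true · v = v
false · v = 0ᵥ

unit : ∀ {k} → Fin k → V k
unit zero = true ∷ 0ᵥ
unit (suc i) = false ∷ unit i

⊞-assoc : ∀ {k} (u v w : V k) → u ⊞ v ⊞ w ≡ u ⊞ (v ⊞ w)
⊞-assoc = zipWith-assoc xor-assoc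

⊞-comm : ∀ {k} (u v : V k) → u ⊞ v ≡ v ⊞ u
⊞-comm = zipWith-comm xor-comm

⊞-identityˡ : ∀ {k} (v : V k) → 0ᵥ ⊞ v ≡ v
⊞-identityˡ = zipWith-identityˡ (λ _ → refl)

⊞-identityʳ : ∀ {k} (v : V k) → v ⊞ 0ᵥ ≡ v
⊞-identityʳ = zipWith-identityʳ xor-identityʳ

⊞-self : ∀ {k} (v : V k) → v ⊞ v ≡ 0ᵥ
⊞-self [] = refl
⊞-self (a ∷ v) = cong₂ _∷_ (xor-same a) (⊞-self v)

·-zeroʳ : ∀ {k} (a : Bool) → a · 0ᵥ {k} ≡ 0ᵥ
·-zeroʳ true = refl
·-zeroʳ false = refl

·-∷ : ∀ {k} a b (v : V k) → a · (b ∷ v) ≡ (a ∧ b) ∷ a · v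
·-∷ true b v = refl
·-∷ false b v = refl

·-distribˡ : ∀ {k} a (u v : V k) → a · (u ⊞ v) ≡ a · u ⊞ a · v
·-distribˡ true u v = refl
·-distribˡ false u v = sym (⊞-identityˡ 0ᵥ)

·-distribʳ : ∀ {k} a b (v : V k) → (a xor b) · v ≡ a · v ⊞ b · v
·-distribʳ true true v = sym (⊞-self v)
·-distribʳ true false v = sym (⊞-identityʳ v)
·-distribʳ false b v = sym (⊞-identityˡ _)

·-assoc : ∀ {k} a b (v : V k) → (a ∧ b) · v ≡ a · b · v
·-assoc true b v = refl
·-assoc false b v = refl

medial : ∀ {k} (a b c d : V k) → (a ⊞ b) ⊞ (c ⊞ d) ≡ (a ⊞ c) ⊞ (b ⊞ d)
medial a b c d = begin
  (a ⊞ b) ⊞ (c ⊞ d)  ≡⟨ ⊞-assoc a b (c ⊞ d) ⟩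
  a ⊞ (b ⊞ (c ⊞ d))  ≡⟨ cong (a ⊞_) (⊞-assoc b c d) ⟨
  a ⊞ (b ⊞ c ⊞ d)    ≡⟨ cong (λ x → a ⊞ (x ⊞ d)) (⊞-comm b c) ⟩
  a ⊞ (c ⊞ b ⊞ d)    ≡⟨ cong (a ⊞_) (⊞-assoc c b d) ⟩
  a ⊞ (c ⊞ (b ⊞ d))  ≡⟨ ⊞-assoc a c (b ⊞ d) ⟨
  (a ⊞ c) ⊞ (b ⊞ d)  ∎
  where open ≡-Reasoning

-- When `bs` holds the rows of a matrix, this is the product of the row vector `u` with it; matrices
-- act on row vectors throughout.
comb : ∀ {n k} → V n → Vec (V k) n → V k
comb [] [] = 0ᵥ
comb (a ∷ u) (b ∷ bs) = a · b ⊞ comb u bs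

comb-⊞ : ∀ {n k} (u v : V n) (bs : Vec (V k) n) → comb (u ⊞ v) bs ≡ comb u bs ⊞ comb v bs
comb-⊞ [] [] [] = sym (⊞-identityˡ 0ᵥ)
comb-⊞ (a ∷ u) (b ∷ v) (w ∷ bs) =
  trans (cong₂ _⊞_ (·-distribʳ a b w) (comb-⊞ u v bs)) (medial (a · w) (b · w) (comb u bs) (comb v bs))

comb-0 : ∀ {n k} (bs : Vec (V k) n) → comb 0ᵥ bs ≡ 0ᵥ
comb-0 [] = refl
comb-0 (b ∷ bs) = trans (⊞-identityˡ _) (comb-0 bs)

comb-unit : ∀ {n k} (i : Fin n) (bs : Vec (V k) n) → comb (unit i) bs ≡ lookup bs i
comb-unit zero (b ∷ bs) = trans (cong (b ⊞_) (comb-0 bs)) (⊞-identityʳ b)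
comb-unit (suc i) (b ∷ bs) = trans (⊞-identityˡ _) (comb-unit i bs)

-- A normal form for sums in a group of exponent two is the 0/1 vector of
-- the parities with which the atoms occur.
data Expr (n : ℕ) : Set where
  var : Fin n → Expr n
  _:+_ : Expr n → Expr n → Expr n
  :0 : Expr n

infixl 6 _:+_

⟦_⟧ : ∀ {n k} → Expr n → Vec (V k) n → V k
⟦ var i ⟧ ρ = lookup ρ i
⟦ e :+ e′ ⟧ ρ = ⟦ e ⟧ ρ ⊞ ⟦ e′ ⟧ ρ
⟦ :0 ⟧ ρ = 0ᵥ

parities : ∀ {n} → Expr n → V n
parities (var i) = unit i
parities (e :+ e′) = parities e ⊞ parities e′
parities :0 = 0ᵥ

⟦⟧-parities : ∀ {n k} (e : Expr n) (ρ : Vec (V k) n) → ⟦ e ⟧ ρ ≡ comb (parities e) ρ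
⟦⟧-parities (var i) ρ = sym (comb-unit i ρ)
⟦⟧-parities (e :+ e′) ρ =
  trans (cong₂ _⊞_ (⟦⟧-parities e ρ) (⟦⟧-parities e′ ρ)) (sym (comb-⊞ (parities e) (parities e′) ρ))
⟦⟧-parities :0 ρ = sym (comb-0 ρ)

-- The parities of closed expressions compute, so the last argument is `refl` whenever the two sides
-- agree modulo 2.
⊞-solve : ∀ {n k} (ρ : Vec (V k) n) (e e′ : Expr n) → parities e ≡ parities e′ → ⟦ e ⟧ ρ ≡ ⟦ e′ ⟧ ρ
⊞-solve ρ e e′ eq = trans (⟦⟧-parities e ρ) (trans (cong (λ u → comb u ρ) eq) (sym (⟦⟧-parities e′ ρ)))

pattern x₀ = var zero
pattern x₁ = var (suc zero)
pattern x₂ = var (suc (suc zero))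
pattern x₃ = var (suc (suc (suc zero)))
pattern x₄ = var (suc (suc (suc (suc zero))))

⊞≡0⇒≡ : ∀ {k} (u v : V k) → u ⊞ v ≡ 0ᵥ → u ≡ v
⊞≡0⇒≡ u v eq = trans (⊞-solve (u ∷ v ∷ []) x₀ (x₀ :+ x₁ :+ x₁) refl) (trans (cong (_⊞ v) eq) (⊞-identityˡ v))

≡⇒⊞≡0 : ∀ {k} {u v : V k} → u ≡ v → u ⊞ v ≡ 0ᵥ
≡⇒⊞≡0 {u = u} refl = ⊞-self u

Additive : ∀ {j k} → (V j → V k) → Set
Additive T = ∀ u v → T (u ⊞ v) ≡ T u ⊞ T v

module _ {j k} {T : V j → V k} (T-⊞ : Additive T) where

  additive-0 : T 0ᵥ ≡ 0ᵥ
  additive-0 = begin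
    T 0ᵥ                 ≡⟨ ⊞-solve (T 0ᵥ ∷ []) x₀ (x₀ :+ x₀ :+ x₀) refl ⟩
    T 0ᵥ ⊞ T 0ᵥ ⊞ T 0ᵥ  ≡⟨ cong (_⊞ T 0ᵥ) (T-⊞ 0ᵥ 0ᵥ) ⟨
    T (0ᵥ ⊞ 0ᵥ) ⊞ T 0ᵥ  ≡⟨ cong (λ v → T v ⊞ T 0ᵥ) (⊞-self 0ᵥ) ⟩
    T 0ᵥ ⊞ T 0ᵥ         ≡⟨ ⊞-self (T 0ᵥ) ⟩
    0ᵥ                   ∎
    where open ≡-Reasoning

  additive-· : ∀ a v → T (a · v) ≡ a · T v
  additive-· true v = refl
  additive-· false v = additive-0

  additive-comb : ∀ {n} (u : V n) bs → T (comb u bs) ≡ comb u (Vec.map T bs)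
  additive-comb [] [] = additive-0
  additive-comb (a ∷ u) (b ∷ bs) =
    trans (T-⊞ (a · b) (comb u bs)) (cong₂ _⊞_ (additive-· a b) (additive-comb u bs))

  additive-injective : (∀ v → T v ≡ 0ᵥ → v ≡ 0ᵥ) → ∀ {u v} → T u ≡ T v → u ≡ v
  additive-injective ker {u} {v} eq = ⊞≡0⇒≡ u v (ker (u ⊞ v) (trans (T-⊞ u v) (≡⇒⊞≡0 eq)))

comb-additive : ∀ {n k} (bs : Vec (V k) n) → Additive (λ u → comb u bs)
comb-additive bs u v = comb-⊞ u v bs

comb-units : ∀ {n} (u : V n) → comb u (tabulate unit) ≡ u
comb-units [] = refl
comb-units {suc n} (a ∷ u) = begin
  a · unit zero ⊞ comb u (tabulate (unit ∘ suc))
    ≡⟨ cong (λ bs → a · unit zero ⊞ comb u bs) (tabulate-∘ (false ∷_) unit) ⟩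
  a · unit zero ⊞ comb u (Vec.map (false ∷_) (tabulate unit))
    ≡⟨ cong (a · unit zero ⊞_) (additive-comb {T = false ∷_} (λ _ _ → refl) u (tabulate unit)) ⟨
  a · unit zero ⊞ (false ∷ comb u (tabulate unit))
    ≡⟨ cong₂ (λ x y → x ⊞ (false ∷ y)) (·-∷ a true 0ᵥ) (comb-units u) ⟩
  ((a ∧ true) xor false) ∷ (a · 0ᵥ ⊞ u)
    ≡⟨ cong₂ _∷_ (lemma a) (trans (cong (_⊞ u) (·-zeroʳ a)) (⊞-identityˡ u)) ⟩
  a ∷ u ∎
  where
  open ≡-Reasoning
  lemma : ∀ a → (a ∧ true) xor false ≡ a
  lemma true = refl
  lemma false = refl

additive-≗ : ∀ {j k} {T T′ : V j → V k} → Additive T → Additive T′ →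
             (∀ i → T (unit i) ≡ T′ (unit i)) → ∀ v → T v ≡ T′ v
additive-≗ {T = T} {T′} T-⊞ T′-⊞ eq v = begin
  T v                                  ≡⟨ cong T (comb-units v) ⟨
  T (comb v (tabulate unit))           ≡⟨ additive-comb T-⊞ v (tabulate unit) ⟩
  comb v (Vec.map T (tabulate unit))   ≡⟨ cong (comb v) (tabulate-∘ T unit) ⟨
  comb v (tabulate (T ∘ unit))         ≡⟨ cong (comb v) (tabulate-cong eq) ⟩
  comb v (tabulate (T′ ∘ unit))        ≡⟨ cong (comb v) (tabulate-∘ T′ unit) ⟩
  comb v (Vec.map T′ (tabulate unit))  ≡⟨ additive-comb T′-⊞ v (tabulate unit) ⟨
  T′ (comb v (tabulate unit))          ≡⟨ cong T′ (comb-units v) ⟩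
  T′ v                                 ∎
  where
  open ≡-Reasoning

-- Polynomials in an additive operator

iter : {A : Set} → (A → A) → ℕ → A → A
iter T zero v = v
iter T (suc n) v = T (iter T n v)

iter-additive : ∀ {k} {T : V k → V k} → Additive T → ∀ n → Additive (iter T n)
iter-additive T-⊞ zero u v = refl
iter-additive {T = T} T-⊞ (suc n) u v = trans (cong T (iter-additive T-⊞ n u v)) (T-⊞ _ _)

iter-shift : {A : Set} (T : A → A) → ∀ n v → iter T n (T v) ≡ T (iter T n v)
iter-shift T zero v = refl
iter-shift T (suc n) v = cong T (iter-shift T n v)

iter-+ : {A : Set} (T : A → A) → ∀ i j v → iter T (i + j) v ≡ iter T i (iter T j v)
iter-+ T zero j v = refl
iter-+ T (suc i) j v = cong T (iter-+ T i j v)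

act : ∀ {k} → (V k → V k) → Poly → V k → V k
act T [] v = 0ᵥ
act T (a ∷ p) v = a · v ⊞ T (act T p v)

-- Horner's scheme only adds and applies `T`, so any additive `φ` that intertwines the operators
-- passes through it. A polynomial in `T` as `φ` gives commutativity, evaluation at a vector gives
-- associativity in F₂[X]/(f) and the module laws, and the first block carries γ to `A`.
act-intertwine : ∀ {j k} {T : V j → V j} {T′ : V k → V k} {φ : V j → V k} → Additive φ →
                 (∀ v → φ (T v) ≡ T′ (φ v)) → ∀ p v → φ (act T p v) ≡ act T′ p (φ v)
act-intertwine φ-⊞ comm [] v = additive-0 φ-⊞
act-intertwine {T′ = T′} φ-⊞ comm (a ∷ p) v =
  trans (φ-⊞ _ _)
    (cong₂ _⊞_ (additive-· φ-⊞ a v) (trans (comm _) (cong T′ (act-intertwine φ-⊞ comm p v))))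

act-cong : ∀ {k} {T T′ : V k → V k} → (∀ v → T v ≡ T′ v) → ∀ p v → act T p v ≡ act T′ p v
act-cong eq = act-intertwine {φ = id} (λ _ _ → refl) eq

module _ {k} {T : V k → V k} (T-⊞ : Additive T) where

  act-additive : ∀ p → Additive (act T p)
  act-additive [] u v = sym (⊞-identityˡ 0ᵥ)
  act-additive (a ∷ p) u v =
    trans (cong₂ _⊞_ (·-distribˡ a u v) (trans (cong T (act-additive p u v)) (T-⊞ _ _)))
      (medial (a · u) (a · v) (T (act T p u)) (T (act T p v)))

  act-shift : ∀ p v → act T p (T v) ≡ T (act T p v)
  act-shift p v = sym (act-intertwine {φ = T} T-⊞ (λ _ → refl) p v)

  act-iter : ∀ p n v → act T p (iter T n v) ≡ iter T n (act T p v)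
  act-iter p zero v = refl
  act-iter p (suc n) v = trans (act-shift p _) (cong T (act-iter p n v))

  act-comm : ∀ p q v → act T p (act T q v) ≡ act T q (act T p v)
  act-comm p q = act-intertwine {φ = act T p} (act-additive p) (act-shift p) q

  act-add : ∀ p q v → act T (addRaw p q) v ≡ act T p v ⊞ act T q v
  act-add [] q v = sym (⊞-identityˡ _)
  act-add (a ∷ p) [] v = sym (⊞-identityʳ _)
  act-add (a ∷ p) (b ∷ q) v =
    trans (cong₂ _⊞_ (·-distribʳ a b v) (trans (cong T (act-add p q v)) (T-⊞ _ _)))
      (medial (a · v) (b · v) (T (act T p v)) (T (act T q v)))

  act-scale : ∀ a q v → act T (scaleRaw a q) v ≡ a · act T q v
  act-scale a [] v = sym (·-zeroʳ a)
  act-scale a (b ∷ q) v =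
    trans (cong₂ _⊞_ (·-assoc a b v) (trans (cong T (act-scale a q v)) (additive-· T-⊞ a _)))
      (sym (·-distribˡ a (b · v) (T (act T q v))))

  act-mul : ∀ p q v → act T (mulRaw p q) v ≡ act T p (act T q v)
  act-mul [] q v = refl
  act-mul (a ∷ p) q v =
    trans (act-add (scaleRaw a q) (false ∷ mulRaw p q) v)
      (cong₂ _⊞_ (act-scale a q v) (trans (⊞-identityˡ _) (cong T (act-mul p q v))))

  act-normalize : ∀ p v → act T (normalize p) v ≡ act T p v
  act-normalize [] v = refl
  act-normalize (a ∷ p) v with normalize p | act-normalize p v
  ... | b ∷ q | eq = cong (λ w → a · v ⊞ T w) eq
  ... | [] | eq with a
  ...   | true = cong (λ w → v ⊞ T w) eq
  ...   | false = sym (trans (⊞-identityˡ _) (trans (cong T (sym eq)) (additive-0 T-⊞)))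

  act-⊕ : ∀ p q v → act T (p ⊕ q) v ≡ act T p v ⊞ act T q v
  act-⊕ p q v = trans (act-normalize (addRaw p q) v) (act-add p q v)

  act-⊗ : ∀ p q v → act T (p ⊗ q) v ≡ act T p (act T q v)
  act-⊗ p q v = trans (act-normalize (mulRaw p q) v) (act-mul p q v)

  act-∷ʳ : ∀ p a v → act T (p ∷ʳ a) v ≡ act T p v ⊞ a · iter T (length p) v
  act-∷ʳ [] a v = trans (cong (a · v ⊞_) (additive-0 T-⊞)) (⊞-comm (a · v) 0ᵥ)
  act-∷ʳ (b ∷ p) a v =
    trans (cong (b · v ⊞_) (trans (cong T (act-∷ʳ p a v))
      (trans (T-⊞ _ _) (cong (T (act T p v) ⊞_) (additive-· T-⊞ a _)))))
      (sym (⊞-assoc (b · v) (T (act T p v)) (a · T (iter T (length p) v))))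

  act-Xpow : ∀ n v → act T (Xpow n) v ≡ iter T n v
  act-Xpow zero v = trans (cong (v ⊞_) (additive-0 T-⊞)) (⊞-identityʳ v)
  act-Xpow (suc n) v = trans (⊞-identityˡ _) (cong T (act-Xpow n v))

orbit : ∀ {k} → (V k → V k) → V k → ∀ n → Vec (V k) n
orbit T v zero = []
orbit T v (suc n) = v ∷ orbit T (T v) n

-- Coefficient vectors of a fixed length serve as polynomials of bounded degree; additivity in the
-- polynomial then comes from `comb`.
comb-orbit : ∀ {k} {T : V k → V k} → Additive T → ∀ {n} (u : V n) v →
             comb u (orbit T v n) ≡ act T (toList u) v
comb-orbit T-⊞ [] v = refl
comb-orbit T-⊞ (a ∷ u) v = cong (a · v ⊞_) (trans (comb-orbit T-⊞ u _) (act-shift T-⊞ (toList u) v))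

act-toList-⊞ : ∀ {k} {T : V k → V k} → Additive T → ∀ {n} (u w : V n) v →
               act T (toList (u ⊞ w)) v ≡ act T (toList u) v ⊞ act T (toList w) v
act-toList-⊞ {T = T} T-⊞ {n} u w v =
  trans (sym (comb-orbit T-⊞ (u ⊞ w) v))
    (trans (comb-⊞ u w (orbit T v n)) (cong₂ _⊞_ (comb-orbit T-⊞ u v) (comb-orbit T-⊞ w v)))

toMat : ∀ {j k} → (V j → V k) → Vec (V k) j
toMat T = tabulate (T ∘ unit)

comb-toMat : ∀ {j k} {T : V j → V k} → Additive T → ∀ v → comb v (toMat T) ≡ T v
comb-toMat {T = T} T-⊞ = additive-≗ (comb-additive (toMat T)) T-⊞
  (λ i → trans (comb-unit i (toMat T)) (lookup∘tabulate (T ∘ unit) i))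

comb-injective : ∀ {j k} (A B : Vec (V k) j) → (∀ v → comb v A ≡ comb v B) → A ≡ B
comb-injective [] [] eq = refl
comb-injective (a ∷ A) (b ∷ B) eq = cong₂ _∷_
  (trans (sym (comb-unit zero (a ∷ A))) (trans (eq (unit zero)) (comb-unit zero (b ∷ B))))
  (comb-injective A B λ v → trans (sym (⊞-identityˡ _)) (trans (eq (false ∷ v)) (⊞-identityˡ _)))

-- The Cayley–Hamilton theorem

-- The algebra A[x₀,…,x_{k-1}]/(x₀²,…,x_{k-1}²): the pair (a , b) stands for a + b x₀.
-- In characteristic two it is the exterior algebra, so determinants
-- appear as top coefficients of products of linear forms.
E : ℕ → Set → Set
E zero A = A
E (suc k) A = E k A × E k A

zipE : ∀ k {A B C : Set} → (A → B → C) → E k A → E k B → E k C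
zipE zero f a b = f a b
zipE (suc k) f (a , b) (c , d) = zipE k f a c , zipE k f b d

mapE : ∀ k {A B : Set} → (A → B) → E k A → E k B
mapE zero f a = f a
mapE (suc k) f (a , b) = mapE k f a , mapE k f b

-- All 2ᵏ coefficients are `a`: this is the zero of the algebra when `a` is zero, not the embedding
-- of scalars.
constE : ∀ k {A : Set} → A → E k A
constE zero a = a
constE (suc k) a = constE k a , constE k a

top : ∀ k {A : Set} → E k A → A
top zero a = a
top (suc k) (_ , b) = top k b

-- The coefficient of the product of all variables except x_j, the monomial at which the derivative
-- of the top monomial has coefficient e_j.
subtop : ∀ {k} {A : Set} → Fin k → E k A → A
subtop {suc k} zero (a , _) = top k a
subtop {suc k} (suc j) (_ , b) = subtop j b

top-zipE : ∀ k {A B C : Set} (f : A → B → C) x y → top k (zipE k f x y) ≡ f (top k x) (top k y)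
top-zipE zero f x y = refl
top-zipE (suc k) f (_ , x) (_ , y) = top-zipE k f x y

top-mapE : ∀ k {A B : Set} (f : A → B) x → top k (mapE k f x) ≡ f (top k x)
top-mapE zero f x = refl
top-mapE (suc k) f (_ , x) = top-mapE k f x

top-constE : ∀ k {A : Set} (a : A) → top k (constE k a) ≡ a
top-constE zero a = refl
top-constE (suc k) a = top-constE k a

subtop-constE : ∀ {k} {A : Set} (j : Fin k) (a : A) → subtop j (constE k a) ≡ a
subtop-constE {suc k} zero a = top-constE k a
subtop-constE {suc k} (suc j) a = subtop-constE j a

mapE-∘ : ∀ k {A B C : Set} (g : B → C) (f : A → B) {h : A → C} → (∀ a → g (f a) ≡ h a) → ∀ x →
         mapE k g (mapE k f x) ≡ mapE k h x
mapE-∘ zero g f eq x = eq x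
mapE-∘ (suc k) g f eq (x , y) = cong₂ _,_ (mapE-∘ k g f eq x) (mapE-∘ k g f eq y)

mapE-zipE : ∀ k {A B C A′ B′ C′ : Set} (h : C → C′) (f : A → B → C) (f′ : A′ → B′ → C′)
            (g : A → A′) (g′ : B → B′) → (∀ a b → h (f a b) ≡ f′ (g a) (g′ b)) → ∀ x y →
            mapE k h (zipE k f x y) ≡ zipE k f′ (mapE k g x) (mapE k g′ y)
mapE-zipE zero h f f′ g g′ eq x y = eq x y
mapE-zipE (suc k) h f f′ g g′ eq (a , b) (c , d) =
  cong₂ _,_ (mapE-zipE k h f f′ g g′ eq a c) (mapE-zipE k h f f′ g g′ eq b d)

mapE-constE : ∀ k {A B : Set} (f : A → B) a → mapE k f (constE k a) ≡ constE k (f a)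
mapE-constE zero f a = refl
mapE-constE (suc k) f a = cong₂ _,_ (mapE-constE k f a) (mapE-constE k f a)

module _ {N : ℕ} where

  infixl 6 _⊞ᴱ_

  _⊞ᴱ_ : ∀ {k} → E k (V N) → E k (V N) → E k (V N)
  _⊞ᴱ_ {k} = zipE k _⊞_

  ⟦_⟧ᴱ : ∀ {n k} → Expr n → Vec (E k (V N)) n → E k (V N)
  ⟦ var i ⟧ᴱ ρ = lookup ρ i
  ⟦_⟧ᴱ {k = k} (e :+ e′) ρ = _⊞ᴱ_ {k} (⟦_⟧ᴱ {k = k} e ρ) (⟦_⟧ᴱ {k = k} e′ ρ)
  ⟦_⟧ᴱ {k = k} :0 ρ = constE k 0ᵥ

  ⟦⟧ᴱ-zero : ∀ {n} (e : Expr n) (ρ : Vec (V N) n) → ⟦_⟧ᴱ {k = 0} e ρ ≡ ⟦ e ⟧ ρ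
  ⟦⟧ᴱ-zero (var i) ρ = refl
  ⟦⟧ᴱ-zero (e :+ e′) ρ = cong₂ _⊞_ (⟦⟧ᴱ-zero e ρ) (⟦⟧ᴱ-zero e′ ρ)
  ⟦⟧ᴱ-zero :0 ρ = refl

  ⟦⟧ᴱ-suc : ∀ {n k} (e : Expr n) (ρ : Vec (E (suc k) (V N)) n) →
            ⟦_⟧ᴱ {k = suc k} e ρ ≡ (⟦_⟧ᴱ {k = k} e (Vec.map proj₁ ρ) , ⟦_⟧ᴱ {k = k} e (Vec.map proj₂ ρ))
  ⟦⟧ᴱ-suc {k = k} (var i) ρ = sym (cong₂ _,_ (lookup-map i proj₁ ρ) (lookup-map i proj₂ ρ))
  ⟦⟧ᴱ-suc {k = k} (e :+ e′) ρ = cong₂ (_⊞ᴱ_ {suc k}) (⟦⟧ᴱ-suc {k = k} e ρ) (⟦⟧ᴱ-suc {k = k} e′ ρ)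
  ⟦⟧ᴱ-suc :0 ρ = refl

  ⊞ᴱ-solve : ∀ k {n} (ρ : Vec (E k (V N)) n) (e e′ : Expr n) → parities e ≡ parities e′ →
             ⟦_⟧ᴱ {k = k} e ρ ≡ ⟦_⟧ᴱ {k = k} e′ ρ
  ⊞ᴱ-solve zero ρ e e′ eq =
    trans (⟦⟧ᴱ-zero e ρ) (trans (⊞-solve ρ e e′ eq) (sym (⟦⟧ᴱ-zero e′ ρ)))
  ⊞ᴱ-solve (suc k) ρ e e′ eq =
    trans (⟦⟧ᴱ-suc {k = k} e ρ)
      (trans (cong₂ _,_ (⊞ᴱ-solve k (Vec.map proj₁ ρ) e e′ eq) (⊞ᴱ-solve k (Vec.map proj₂ ρ) e e′ eq))
        (sym (⟦⟧ᴱ-suc {k = k} e′ ρ)))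

-- Products of linear forms and Laplace expansion

addE : ∀ k → E k Poly → E k Poly → E k Poly
addE k = zipE k addRaw

scaleE : ∀ k → Poly → E k Poly → E k Poly
scaleE k r = mapE k (mulRaw r)

oneE : ∀ k → E k Poly
oneE zero = one
oneE (suc k) = oneE k , constE k []

-- Multiplying a + b x₀ by a form r x₀ + ⋯ yields no term in r b, because x₀² = 0.
mulLin : ∀ {k} → Vec Poly k → E k Poly → E k Poly
mulLin [] w = []
mulLin {suc k} (r ∷ rs) (a , b) = mulLin rs a , addE k (mulLin rs b) (scaleE k r a)

prodLin : ∀ {k n} → Vec (Vec Poly k) n → E k Poly
prodLin {k} [] = oneE k
prodLin (r ∷ rs) = mulLin r (prodLin rs)

-- The quotient map x_j = 0. It deletes the j-th coefficient of every linear form, so it leads from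
-- a product of rows to the product that belongs to a minor.
kill : ∀ {k} {A : Set} → Fin (suc k) → E (suc k) A → E k A
kill zero (a , _) = a
kill {suc k} (suc j) (a , b) = kill j a , kill j b

kill-zipE : ∀ {k} {A B C : Set} (f : A → B → C) (j : Fin (suc k)) x y →
            kill j (zipE (suc k) f x y) ≡ zipE k f (kill j x) (kill j y)
kill-zipE f zero x y = refl
kill-zipE {suc k} f (suc j) (a , b) (c , d) = cong₂ _,_ (kill-zipE f j a c) (kill-zipE f j b d)

kill-mapE : ∀ {k} {A B : Set} (f : A → B) (j : Fin (suc k)) x →
            kill j (mapE (suc k) f x) ≡ mapE k f (kill j x)
kill-mapE f zero x = refl
kill-mapE {suc k} f (suc j) (a , b) = cong₂ _,_ (kill-mapE f j a) (kill-mapE f j b)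

kill-constE : ∀ {k} {A : Set} (j : Fin (suc k)) (a : A) → kill j (constE (suc k) a) ≡ constE k a
kill-constE zero a = refl
kill-constE {suc k} (suc j) a = cong₂ _,_ (kill-constE j a) (kill-constE j a)

kill-oneE : ∀ {k} (j : Fin (suc k)) → kill j (oneE (suc k)) ≡ oneE k
kill-oneE zero = refl
kill-oneE {suc k} (suc j) = cong₂ _,_ (kill-oneE j) (kill-constE j [])

kill-mulLin : ∀ {k} (j : Fin (suc k)) (r : Vec Poly (suc k)) w →
              kill j (mulLin r w) ≡ mulLin (removeAt r j) (kill j w)
kill-mulLin zero (r ∷ rs) (a , b) = refl
kill-mulLin {suc k} (suc j) (r ∷ rs@(_ ∷ _)) (a , b) = cong₂ _,_ (kill-mulLin j rs a)
  (trans (kill-zipE addRaw j (mulLin rs b) (scaleE (suc k) r a))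
    (cong₂ (addE k) (kill-mulLin j rs b) (kill-mapE (mulRaw r) j a)))

kill-prodLin : ∀ {k n} (j : Fin (suc k)) (rs : Vec (Vec Poly (suc k)) n) →
               kill j (prodLin rs) ≡ prodLin (Vec.map (λ r → removeAt r j) rs)
kill-prodLin j [] = kill-oneE j
kill-prodLin j (r ∷ rs) =
  trans (kill-mulLin j r (prodLin rs)) (cong (mulLin (removeAt r j)) (kill-prodLin j rs))

sumᵥ : ∀ {n k} → (Fin n → V k) → V k
sumᵥ {zero} f = 0ᵥ
sumᵥ {suc n} f = f zero ⊞ sumᵥ (f ∘ suc)

sumᵥ-cong : ∀ {n k} {f g : Fin n → V k} → (∀ i → f i ≡ g i) → sumᵥ f ≡ sumᵥ g
sumᵥ-cong {zero} eq = refl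
sumᵥ-cong {suc n} eq = cong₂ _⊞_ (eq zero) (sumᵥ-cong (eq ∘ suc))

module _ {N} {T : V N → V N} (T-⊞ : Additive T) where

  act-sumFin : ∀ {n} (f : Fin n → Poly) v → act T (sumFin f) v ≡ sumᵥ (λ j → act T (f j) v)
  act-sumFin {zero} f v = refl
  act-sumFin {suc n} f v =
    trans (act-⊕ T-⊞ (f zero) _ v) (cong (act T (f zero) v ⊞_) (act-sumFin (f ∘ suc) v))

  -- Laplace expansion: the top monomial arises from a term in x_j of the form `r` and a monomial of
  -- `w` free of x_j, and `kill j` retains just the latter.
  act-top-mulLin : ∀ {k} (r : Vec Poly (suc k)) w v →
                   act T (top (suc k) (mulLin r w)) v ≡
                   sumᵥ (λ j → act T (lookup r j) (act T (top k (kill j w)) v))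
  act-top-mulLin {k} (r ∷ rs) (a , b) v = begin
    act T (top k (addE k (mulLin rs b) (scaleE k r a))) v
      ≡⟨ cong (λ p → act T p v) (top-zipE k addRaw (mulLin rs b) (scaleE k r a)) ⟩
    act T (addRaw (top k (mulLin rs b)) (top k (scaleE k r a))) v
      ≡⟨ act-add T-⊞ (top k (mulLin rs b)) _ v ⟩
    act T (top k (mulLin rs b)) v ⊞ act T (top k (scaleE k r a)) v
      ≡⟨ ⊞-comm _ _ ⟩
    act T (top k (scaleE k r a)) v ⊞ act T (top k (mulLin rs b)) v
      ≡⟨ cong₂ _⊞_ (trans (cong (λ p → act T p v) (top-mapE k (mulRaw r) a)) (act-mul T-⊞ r (top k a) v))
                   (rest k rs a b) ⟩
    act T r (act T (top k a) v) ⊞ sumᵥ (λ j → act T (lookup rs j) (act T (top k (kill (suc j) (a , b))) v)) ∎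
    where
    open ≡-Reasoning
    rest : ∀ k (rs : Vec Poly k) a b → act T (top k (mulLin rs b)) v ≡
           sumᵥ (λ j → act T (lookup rs j) (act T (top k (kill (suc j) (a , b))) v))
    rest zero [] a b = refl
    rest (suc k) rs a b = act-top-mulLin rs b v

  -- The two polynomials are compared as operators because `det` normalizes at every step and
  -- `prodLin` does not, so as lists they may differ.
  act-det : ∀ {k} (M : Mat Poly k) v → act T (det M) v ≡ act T (top k (prodLin M)) v
  act-det [] v = refl
  act-det {suc k} (row ∷ rows) v = begin
    act T (sumFin (λ j → lookup row j ⊗ det (minor j))) v
      ≡⟨ act-sumFin (λ j → lookup row j ⊗ det (minor j)) v ⟩
    sumᵥ (λ j → act T (lookup row j ⊗ det (minor j)) v)
      ≡⟨ sumᵥ-cong (λ j → trans (act-⊗ T-⊞ (lookup row j) (det (minor j)) v)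
           (cong (act T (lookup row j)) (trans (act-det (minor j) v)
             (cong (λ w → act T (top k w) v) (sym (kill-prodLin j rows)))))) ⟩
    sumᵥ (λ j → act T (lookup row j) (act T (top k (kill j (prodLin rows))) v))
      ≡⟨ act-top-mulLin row (prodLin rows) v ⟨
    act T (top (suc k) (prodLin (row ∷ rows))) v ∎
    where
    open ≡-Reasoning
    minor : Fin (suc k) → Mat Poly k
    minor j = Vec.map (λ r → removeAt r j) rows

  actE : ∀ k → E k Poly → V N → E k (V N)
  actE k w e = mapE k (λ p → act T p e) w

  scaleᴱ : ∀ k → Poly → E k (V N) → E k (V N)
  scaleᴱ k r = mapE k (act T r)

  -- The derivation of E with ∂ x_j = e_j; it respects x_j² = 0 since 2 x_j e_j = 0.
  ∂ : ∀ {k} → Vec (V N) k → E k Poly → E k (V N)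
  ∂ [] w = 0ᵥ
  ∂ {suc k} (e ∷ es) (a , b) = _⊞ᴱ_ {k = k} (∂ es a) (actE k b e) , ∂ es b

  mulLinᴱ : ∀ {k} → Vec Poly k → E k (V N) → E k (V N)
  mulLinᴱ [] w = 0ᵥ
  mulLinᴱ {suc k} (r ∷ rs) (a , b) = mulLinᴱ rs a , _⊞ᴱ_ {k = k} (mulLinᴱ rs b) (scaleᴱ k r a)

  dot : ∀ {k} → Vec Poly k → Vec (V N) k → V N
  dot [] [] = 0ᵥ
  dot (r ∷ rs) (e ∷ es) = act T r e ⊞ dot rs es

  actE-addE : ∀ k x y e → actE k (addE k x y) e ≡ _⊞ᴱ_ {k = k} (actE k x e) (actE k y e)
  actE-addE k x y e = mapE-zipE k _ addRaw _⊞_ _ _ (λ p q → act-add T-⊞ p q e) x y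

  actE-⊞ : ∀ k w e e′ → actE k w (e ⊞ e′) ≡ _⊞ᴱ_ {k = k} (actE k w e) (actE k w e′)
  actE-⊞ zero w e e′ = act-additive T-⊞ w e e′
  actE-⊞ (suc k) (a , b) e e′ = cong₂ _,_ (actE-⊞ k a e e′) (actE-⊞ k b e e′)

  actE-scaleE : ∀ k r w e → actE k (scaleE k r w) e ≡ actE k w (act T r e)
  actE-scaleE k r w e = mapE-∘ k _ (mulRaw r) (λ p → trans (act-mul T-⊞ r p e) (act-comm T-⊞ r p e)) w

  scaleᴱ-actE : ∀ k r w e → scaleᴱ k r (actE k w e) ≡ actE k w (act T r e)
  scaleᴱ-actE k r w e = mapE-∘ k (act T r) _ (λ p → act-comm T-⊞ r p e) w

  scaleᴱ-⊞ : ∀ k r x y → scaleᴱ k r (_⊞ᴱ_ {k = k} x y) ≡ _⊞ᴱ_ {k = k} (scaleᴱ k r x) (scaleᴱ k r y)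
  scaleᴱ-⊞ k r = mapE-zipE k (act T r) _⊞_ _⊞_ (act T r) (act T r) (act-additive T-⊞ r)

  mulLinᴱ-⊞ : ∀ {k} (rs : Vec Poly k) x y →
              mulLinᴱ rs (_⊞ᴱ_ {k = k} x y) ≡ _⊞ᴱ_ {k = k} (mulLinᴱ rs x) (mulLinᴱ rs y)
  mulLinᴱ-⊞ [] x y = sym (⊞-identityˡ 0ᵥ)
  mulLinᴱ-⊞ {suc k} (r ∷ rs) (a , b) (c , d) = cong₂ _,_ (mulLinᴱ-⊞ rs a c)
    (trans (cong₂ (_⊞ᴱ_ {k = k}) (mulLinᴱ-⊞ rs b d) (scaleᴱ-⊞ k r a c))
      (⊞ᴱ-solve k (mulLinᴱ rs b ∷ mulLinᴱ rs d ∷ scaleᴱ k r a ∷ scaleᴱ k r c ∷ [])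
        (x₀ :+ x₁ :+ (x₂ :+ x₃)) (x₀ :+ x₂ :+ (x₁ :+ x₃)) refl))

  mulLinᴱ-0 : ∀ {k} (rs : Vec Poly k) → mulLinᴱ rs (constE k 0ᵥ) ≡ constE k 0ᵥ
  mulLinᴱ-0 [] = refl
  mulLinᴱ-0 {suc k} (r ∷ rs) = cong₂ _,_ (mulLinᴱ-0 rs)
    (trans (cong₂ (_⊞ᴱ_ {k = k}) (mulLinᴱ-0 rs)
      (trans (mapE-constE k (act T r) 0ᵥ) (cong (constE k) (additive-0 (act-additive T-⊞ r)))))
      (⊞ᴱ-solve k [] (:0 :+ :0) :0 refl))

  ∂-addE : ∀ {k} (es : Vec (V N) k) x y → ∂ es (addE k x y) ≡ _⊞ᴱ_ {k = k} (∂ es x) (∂ es y)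
  ∂-addE [] x y = sym (⊞-identityˡ 0ᵥ)
  ∂-addE {suc k} (e ∷ es) (a , b) (c , d) = cong₂ _,_
    (trans (cong₂ (_⊞ᴱ_ {k = k}) (∂-addE es a c) (actE-addE k b d e))
      (⊞ᴱ-solve k (∂ es a ∷ ∂ es c ∷ actE k b e ∷ actE k d e ∷ [])
        (x₀ :+ x₁ :+ (x₂ :+ x₃)) (x₀ :+ x₂ :+ (x₁ :+ x₃)) refl))
    (∂-addE es b d)

  ∂-scaleE : ∀ {k} (es : Vec (V N) k) r w → ∂ es (scaleE k r w) ≡ scaleᴱ k r (∂ es w)
  ∂-scaleE [] r w = sym (additive-0 (act-additive T-⊞ r))
  ∂-scaleE {suc k} (e ∷ es) r (a , b) = cong₂ _,_
    (trans (cong₂ (_⊞ᴱ_ {k = k}) (∂-scaleE es r a)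
             (trans (actE-scaleE k r b e) (sym (scaleᴱ-actE k r b e))))
      (sym (scaleᴱ-⊞ k r (∂ es a) (actE k b e))))
    (∂-scaleE es r b)

  actE-mulLin : ∀ {k} (rs : Vec Poly k) w e → actE k (mulLin rs w) e ≡ mulLinᴱ rs (actE k w e)
  actE-mulLin [] w e = refl
  actE-mulLin {suc k} (r ∷ rs) (a , b) e = cong₂ _,_ (actE-mulLin rs a e)
    (trans (actE-addE k (mulLin rs b) (scaleE k r a) e)
      (cong₂ (_⊞ᴱ_ {k = k}) (actE-mulLin rs b e)
        (trans (actE-scaleE k r a e) (sym (scaleᴱ-actE k r a e)))))

  -- Leibniz rule, with `dot rs es` the value of ∂ on the linear form; in characteristic two there
  -- are no signs.
  ∂-mulLin : ∀ {k} (rs : Vec Poly k) (es : Vec (V N) k) w →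
             ∂ es (mulLin rs w) ≡ _⊞ᴱ_ {k = k} (mulLinᴱ rs (∂ es w)) (actE k w (dot rs es))
  ∂-mulLin [] [] w = sym (trans (⊞-identityˡ _) (additive-0 (act-additive T-⊞ w)))
  ∂-mulLin {suc k} (r ∷ rs) (e ∷ es) (a , b) = cong₂ _,_ fst snd
    where
    open ≡-Reasoning
    infixl 6 _⊹_
    _⊹_ = _⊞ᴱ_ {N} {k}
    d = dot rs es
    fst : ∂ es (mulLin rs a) ⊹ actE k (addE k (mulLin rs b) (scaleE k r a)) e ≡
          mulLinᴱ rs (∂ es a ⊹ actE k b e) ⊹ actE k a (act T r e ⊞ d)
    fst = begin
      ∂ es (mulLin rs a) ⊹ actE k (addE k (mulLin rs b) (scaleE k r a)) e
        ≡⟨ cong₂ _⊹_ (∂-mulLin rs es a) (trans (actE-addE k (mulLin rs b) (scaleE k r a) e)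
             (cong₂ _⊹_ (actE-mulLin rs b e) (actE-scaleE k r a e))) ⟩
      mulLinᴱ rs (∂ es a) ⊹ actE k a d ⊹ (mulLinᴱ rs (actE k b e) ⊹ actE k a (act T r e))
        ≡⟨ ⊞ᴱ-solve k (mulLinᴱ rs (∂ es a) ∷ actE k a d ∷ mulLinᴱ rs (actE k b e) ∷ actE k a (act T r e) ∷ [])
             (x₀ :+ x₁ :+ (x₂ :+ x₃)) (x₀ :+ x₂ :+ (x₃ :+ x₁)) refl ⟩
      mulLinᴱ rs (∂ es a) ⊹ mulLinᴱ rs (actE k b e) ⊹ (actE k a (act T r e) ⊹ actE k a d)
        ≡⟨ cong₂ _⊹_ (mulLinᴱ-⊞ rs (∂ es a) (actE k b e)) (actE-⊞ k a (act T r e) d) ⟨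
      mulLinᴱ rs (∂ es a ⊹ actE k b e) ⊹ actE k a (act T r e ⊞ d) ∎
    snd : ∂ es (addE k (mulLin rs b) (scaleE k r a)) ≡
          mulLinᴱ rs (∂ es b) ⊹ scaleᴱ k r (∂ es a ⊹ actE k b e) ⊹ actE k b (act T r e ⊞ d)
    snd = begin
      ∂ es (addE k (mulLin rs b) (scaleE k r a))
        ≡⟨ trans (∂-addE es (mulLin rs b) (scaleE k r a))
             (cong₂ _⊹_ (∂-mulLin rs es b) (∂-scaleE es r a)) ⟩
      mulLinᴱ rs (∂ es b) ⊹ actE k b d ⊹ scaleᴱ k r (∂ es a)
        -- `actE k b (act T r e)` enters twice on the right and cancels; this is the identity 2 x₀
        -- e₀ = 0.
        ≡⟨ ⊞ᴱ-solve k (mulLinᴱ rs (∂ es b) ∷ actE k b d ∷ scaleᴱ k r (∂ es a) ∷ actE k b (act T r e) ∷ [])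
             (x₀ :+ x₁ :+ x₂) (x₀ :+ (x₂ :+ x₃) :+ (x₃ :+ x₁)) refl ⟩
      mulLinᴱ rs (∂ es b) ⊹ (scaleᴱ k r (∂ es a) ⊹ actE k b (act T r e)) ⊹ (actE k b (act T r e) ⊹ actE k b d)
        ≡⟨ cong₂ (λ x y → mulLinᴱ rs (∂ es b) ⊹ x ⊹ y)
             (trans (scaleᴱ-⊞ k r (∂ es a) (actE k b e)) (cong (scaleᴱ k r (∂ es a) ⊹_) (scaleᴱ-actE k r b e)))
             (actE-⊞ k b (act T r e) d) ⟨
      mulLinᴱ rs (∂ es b) ⊹ scaleᴱ k r (∂ es a ⊹ actE k b e) ⊹ actE k b (act T r e ⊞ d) ∎

  ∂-const-[] : ∀ {k} (es : Vec (V N) k) → ∂ es (constE k []) ≡ constE k 0ᵥ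
  ∂-const-[] [] = refl
  ∂-const-[] {suc k} (e ∷ es) = cong₂ _,_
    (trans (cong₂ (_⊞ᴱ_ {k = k}) (∂-const-[] es) (mapE-constE k _ []))
      (⊞ᴱ-solve k [] (:0 :+ :0) :0 refl))
    (∂-const-[] es)

  ∂-oneE : ∀ {k} (es : Vec (V N) k) → ∂ es (oneE k) ≡ constE k 0ᵥ
  ∂-oneE [] = refl
  ∂-oneE {suc k} (e ∷ es) = cong₂ _,_
    (trans (cong₂ (_⊞ᴱ_ {k = k}) (∂-oneE es) (mapE-constE k _ []))
      (⊞ᴱ-solve k [] (:0 :+ :0) :0 refl))
    (∂-const-[] es)

  ∂-prodLin : ∀ {k n} (es : Vec (V N) k) (rs : Vec (Vec Poly k) n) →
              (∀ i → dot (lookup rs i) es ≡ 0ᵥ) → ∂ es (prodLin rs) ≡ constE k 0ᵥ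
  ∂-prodLin es [] eq = ∂-oneE es
  ∂-prodLin {k} es (r ∷ rs) eq = begin
    ∂ es (mulLin r (prodLin rs))
      ≡⟨ ∂-mulLin r es (prodLin rs) ⟩
    _⊞ᴱ_ {k = k} (mulLinᴱ r (∂ es (prodLin rs))) (actE k (prodLin rs) (dot r es))
      ≡⟨ cong₂ (_⊞ᴱ_ {k = k}) (trans (cong (mulLinᴱ r) (∂-prodLin es rs (eq ∘ suc))) (mulLinᴱ-0 r))
           (trans (cong (actE k (prodLin rs)) (eq zero)) (actE-0 k (prodLin rs))) ⟩
    _⊞ᴱ_ {k = k} (constE k 0ᵥ) (constE k 0ᵥ)
      ≡⟨ ⊞ᴱ-solve k [] (:0 :+ :0) :0 refl ⟩
    constE k 0ᵥ ∎
    where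
    open ≡-Reasoning
    actE-0 : ∀ k w → actE k w 0ᵥ ≡ constE k 0ᵥ
    actE-0 zero w = additive-0 (act-additive T-⊞ w)
    actE-0 (suc k) (a , b) = cong₂ _,_ (actE-0 k a) (actE-0 k b)

  -- ∂ lowers the degree by one, so this monomial can only come from the top one.
  subtop-∂ : ∀ {k} (j : Fin k) (es : Vec (V N) k) w → subtop j (∂ es w) ≡ act T (top k w) (lookup es j)
  subtop-∂ {suc k} zero (e ∷ es) (a , b) =
    trans (top-zipE k _⊞_ (∂ es a) (actE k b e))
      (trans (cong₂ _⊞_ (top-∂ es a) (top-mapE k _ b)) (⊞-identityˡ _))
    where
    top-∂ : ∀ {k} (es : Vec (V N) k) w → top k (∂ es w) ≡ 0ᵥ
    top-∂ [] w = refl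
    top-∂ (e ∷ es) (_ , w) = top-∂ es w
  subtop-∂ {suc k} (suc j) (e ∷ es) (a , b) = subtop-∂ j es b

  -- The rows of `M` are linear forms on which ∂ vanishes, so by the Leibniz rule ∂ vanishes on
  -- their product. The top coefficient of the product is the determinant, and the coefficients of
  -- its derivative just below the top are the determinant applied to the vectors of `es`. This
  -- replaces the adjugate matrix.
  det-annihilates : ∀ {k} (M : Mat Poly k) (es : Vec (V N) k) → (∀ i → dot (lookup M i) es ≡ 0ᵥ) →
                    ∀ j → act T (det M) (lookup es j) ≡ 0ᵥ
  det-annihilates {k} M es eq j = begin
    act T (det M) (lookup es j)                ≡⟨ act-det M (lookup es j) ⟩
    act T (top k (prodLin M)) (lookup es j)    ≡⟨ subtop-∂ j es (prodLin M) ⟨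
    subtop j (∂ es (prodLin M))                ≡⟨ cong (subtop j) (∂-prodLin es M eq) ⟩
    subtop j (constE k 0ᵥ)                     ≡⟨ subtop-constE j 0ᵥ ⟩
    0ᵥ                                         ∎
    where open ≡-Reasoning

  dot-linear : ∀ {k} (f g : Fin k → Bool) (es : Vec (V N) k) →
               dot (tabulate λ j → normalize (f j ∷ g j ∷ [])) es ≡
               comb (tabulate f) es ⊞ T (comb (tabulate g) es)
  dot-linear f g [] = sym (trans (⊞-identityˡ _) (additive-0 T-⊞))
  dot-linear f g (e ∷ es) = begin
    act T (normalize (f zero ∷ g zero ∷ [])) e ⊞ dot (tabulate λ j → normalize (f (suc j) ∷ g (suc j) ∷ [])) es
      ≡⟨ cong₂ _⊞_ (act-normalize T-⊞ (f zero ∷ g zero ∷ []) e) (dot-linear (f ∘ suc) (g ∘ suc) es) ⟩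
    (f zero · e ⊞ T (g zero · e ⊞ T 0ᵥ)) ⊞ (F ⊞ T G)
      ≡⟨ cong (λ x → (f zero · e ⊞ T x) ⊞ (F ⊞ T G)) (trans (cong (g zero · e ⊞_) (additive-0 T-⊞)) (⊞-identityʳ _)) ⟩
    (f zero · e ⊞ T (g zero · e)) ⊞ (F ⊞ T G)
      ≡⟨ medial _ _ _ _ ⟩
    (f zero · e ⊞ F) ⊞ (T (g zero · e) ⊞ T G)
      ≡⟨ cong ((f zero · e ⊞ F) ⊞_) (T-⊞ _ _) ⟨
    (f zero · e ⊞ F) ⊞ T (g zero · e ⊞ G) ∎
    where
    open ≡-Reasoning
    F = comb (tabulate (f ∘ suc)) es
    G = comb (tabulate (g ∘ suc)) es

tabulate-δ : ∀ {k} (i : Fin k) → tabulate (δ i) ≡ unit i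
tabulate-δ zero = cong (true ∷_) (zeros _)
  where
  zeros : ∀ k → tabulate {n = k} (λ _ → false) ≡ 0ᵥ
  zeros zero = refl
  zeros (suc k) = cong (false ∷_) (zeros k)
tabulate-δ (suc i) = cong (false ∷_) (tabulate-δ i)

rowAct : ∀ {k} → Mat Bool k → V k → V k
rowAct M v = comb v M

-- Row i of X I + M, evaluated at the unit vectors with X acting as M, gives e_i M + e_i M = 0. So
-- the determinant annihilates every unit vector.
cayley-hamilton : ∀ {k} (M : Mat Bool k) v → act (rowAct M) (charPoly M) v ≡ 0ᵥ
cayley-hamilton {k} M = additive-≗ (act-additive M-⊞ (charPoly M)) (λ _ _ → sym (⊞-identityˡ 0ᵥ))
  λ j → trans (cong (act (rowAct M) (charPoly M)) (sym (lookup∘tabulate unit j)))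
          (det-annihilates M-⊞ _ (tabulate unit) kernel j)
  where
  open ≡-Reasoning
  M-⊞ = comb-additive M
  kernel : ∀ i → dot M-⊞ (lookup (tabulate λ i → tabulate λ j →
             normalize (lookup (lookup M i) j ∷ δ i j ∷ [])) i) (tabulate unit) ≡ 0ᵥ
  kernel i = begin
    dot M-⊞ (lookup (tabulate _) i) (tabulate unit)
      ≡⟨ cong (λ r → dot M-⊞ r (tabulate unit)) (lookup∘tabulate _ i) ⟩
    dot M-⊞ (tabulate _) (tabulate unit)
      ≡⟨ dot-linear M-⊞ (lookup (lookup M i)) (δ i) (tabulate unit) ⟩
    comb (tabulate (lookup (lookup M i))) (tabulate unit) ⊞ comb (comb (tabulate (δ i)) (tabulate unit)) M
      ≡⟨ cong₂ _⊞_ (trans (comb-units _) (tabulate∘lookup (lookup M i)))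
           (trans (cong (λ u → comb u M) (trans (comb-units _) (tabulate-δ i))) (comb-unit i M)) ⟩
    lookup M i ⊞ lookup M i
      ≡⟨ ⊞-self (lookup M i) ⟩
    0ᵥ ∎

-- The characteristic polynomial is monic

coeff : Poly → ℕ → Bool
coeff [] i = false
coeff (a ∷ p) zero = a
coeff (a ∷ p) (suc i) = coeff p i

coeff-addRaw : ∀ p q i → coeff (addRaw p q) i ≡ coeff p i xor coeff q i
coeff-addRaw [] q i = refl
coeff-addRaw (a ∷ p) [] i = sym (xor-identityʳ _)
coeff-addRaw (a ∷ p) (b ∷ q) zero = refl
coeff-addRaw (a ∷ p) (b ∷ q) (suc i) = coeff-addRaw p q i

coeff-scaleRaw : ∀ a q i → coeff (scaleRaw a q) i ≡ a ∧ coeff q i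
coeff-scaleRaw a [] i = sym (∧-zeroʳ a)
coeff-scaleRaw a (b ∷ q) zero = refl
coeff-scaleRaw a (b ∷ q) (suc i) = coeff-scaleRaw a q i

coeff-normalize : ∀ p i → coeff (normalize p) i ≡ coeff p i
coeff-normalize [] i = refl
coeff-normalize (a ∷ p) i with normalize p | coeff-normalize p
coeff-normalize (a ∷ p) zero    | b ∷ q | eq = refl
coeff-normalize (a ∷ p) (suc i) | b ∷ q | eq = eq i
coeff-normalize (true ∷ p) zero | [] | eq = refl
coeff-normalize (true ∷ p) (suc i) | [] | eq = eq i
coeff-normalize (false ∷ p) zero | [] | eq = refl
coeff-normalize (false ∷ p) (suc i) | [] | eq = eq i

normalize-zero : ∀ p → (∀ i → coeff p i ≡ false) → normalize p ≡ []
normalize-zero [] eq = refl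
normalize-zero (a ∷ p) eq rewrite normalize-zero p (eq ∘ suc) | eq 0 = refl

normalize-cong : ∀ p q → (∀ i → coeff p i ≡ coeff q i) → normalize p ≡ normalize q
normalize-cong [] q eq = sym (normalize-zero q (λ i → sym (eq i)))
normalize-cong (a ∷ p) [] eq = normalize-zero (a ∷ p) eq
normalize-cong (a ∷ p) (b ∷ q) eq rewrite normalize-cong p q (eq ∘ suc) | eq 0 = refl

normalize-idem : ∀ p → normalize (normalize p) ≡ normalize p
normalize-idem p = normalize-cong (normalize p) p (coeff-normalize p)

normalize-∷ʳ : ∀ p → normalize (p ∷ʳ true) ≡ p ∷ʳ true
normalize-∷ʳ [] = refl
normalize-∷ʳ (a ∷ p) rewrite normalize-∷ʳ p with p
... | [] = refl
... | _ ∷ _ = refl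

length-normalize : ∀ p → length (normalize p) ≤ length p
length-normalize [] = z≤n
length-normalize (a ∷ p) with normalize p | length-normalize p
... | b ∷ q | le = s≤s le
... | [] | le with a
...   | true = s≤s z≤n
...   | false = z≤n

pad : ∀ d → Poly → V d
pad zero p = []
pad (suc d) [] = false ∷ pad d []
pad (suc d) (a ∷ p) = a ∷ pad d p

pad-[] : ∀ d → pad d [] ≡ 0ᵥ
pad-[] zero = refl
pad-[] (suc d) = cong (false ∷_) (pad-[] d)

pad-toList : ∀ {d} (u : V d) → pad d (toList u) ≡ u
pad-toList [] = refl
pad-toList (a ∷ u) = cong (a ∷_) (pad-toList u)

coeff-pad-∷ʳ : ∀ d p → coeff p d ≡ true → (∀ i → d < i → coeff p i ≡ false) →
               ∀ i → coeff p i ≡ coeff (toList (pad d p) ∷ʳ true) i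
coeff-pad-∷ʳ zero (a ∷ p) lead bound zero = lead
coeff-pad-∷ʳ zero (a ∷ p) lead bound (suc i) = bound (suc i) (s≤s z≤n)
coeff-pad-∷ʳ (suc d) (a ∷ p) lead bound zero = refl
coeff-pad-∷ʳ (suc d) (a ∷ p) lead bound (suc i) = coeff-pad-∷ʳ d p lead (λ i le → bound (suc i) (s≤s le)) i

monic-form : ∀ d p → normalize p ≡ p → coeff p d ≡ true → (∀ i → d < i → coeff p i ≡ false) →
             p ≡ toList (pad d p) ∷ʳ true
monic-form d p norm lead bound =
  trans (sym norm)
    (trans (normalize-cong p (toList (pad d p) ∷ʳ true) (coeff-pad-∷ʳ d p lead bound))
      (normalize-∷ʳ (toList (pad d p))))

linear : Bool → Bool → Poly
linear a b = normalize (a ∷ b ∷ [])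

coeff-linear-mul : ∀ a b p i →
  coeff (linear a b ⊗ p) (suc i) ≡ (a ∧ coeff p (suc i)) xor (b ∧ coeff p i)
coeff-linear-mul a b p i = trans (coeff-normalize (mulRaw (linear a b) p) (suc i)) (lemma a b)
  where
  zeros : ∀ i → coeff (false ∷ []) i ≡ false
  zeros zero = refl
  zeros (suc i) = refl
  constant : ∀ q i → coeff (mulRaw (true ∷ []) q) i ≡ coeff q i
  constant q i = trans (coeff-addRaw (scaleRaw true q) (false ∷ []) i)
    (trans (cong₂ _xor_ (coeff-scaleRaw true q i) (zeros i)) (xor-identityʳ _))
  lemma : ∀ a b → coeff (mulRaw (linear a b) p) (suc i) ≡ (a ∧ coeff p (suc i)) xor (b ∧ coeff p i)
  lemma true true = trans (coeff-addRaw (scaleRaw true p) _ (suc i))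
    (cong₂ _xor_ (coeff-scaleRaw true p (suc i)) (constant p i))
  lemma true false = trans (constant p (suc i)) (sym (xor-identityʳ _))
  lemma false true = trans (coeff-addRaw (scaleRaw false p) _ (suc i))
    (cong₂ _xor_ (coeff-scaleRaw false p (suc i)) (constant p i))
  lemma false false = refl

sum₂ : ∀ {n} → (Fin n → Bool) → Bool
sum₂ {zero} f = false
sum₂ {suc n} f = f zero xor sum₂ (f ∘ suc)

det₂ : ∀ {k} → Mat Bool k → Bool
det₂ {zero} [] = true
det₂ {suc k} (row ∷ rows) = sum₂ λ j → lookup row j ∧ det₂ (Vec.map (λ r → removeAt r j) rows)

sum₂-zero : ∀ {n} (f : Fin n → Bool) → (∀ j → f j ≡ false) → sum₂ f ≡ false
sum₂-zero {zero} f eq = refl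
sum₂-zero {suc n} f eq = cong₂ _xor_ (eq zero) (sum₂-zero (f ∘ suc) (eq ∘ suc))

sum₂-cong : ∀ {n} {f g : Fin n → Bool} → (∀ j → f j ≡ g j) → sum₂ f ≡ sum₂ g
sum₂-cong {zero} eq = refl
sum₂-cong {suc n} eq = cong₂ _xor_ (eq zero) (sum₂-cong (eq ∘ suc))

coeff-sumFin : ∀ {n} (f : Fin n → Poly) i → coeff (sumFin f) i ≡ sum₂ (λ j → coeff (f j) i)
coeff-sumFin {zero} f i = refl
coeff-sumFin {suc n} f i = trans (coeff-normalize (addRaw (f zero) _) i)
  (trans (coeff-addRaw (f zero) _ i) (cong (coeff (f zero) i xor_) (coeff-sumFin (f ∘ suc) i)))

-- The matrix A + X B. A minor of X I + T need not have the same shape, so the induction for the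
-- leading coefficient runs over arbitrary `B`.
pencil : ∀ {k n} → Vec (V k) n → Vec (V k) n → Vec (Vec Poly k) n
pencil = zipWith (zipWith linear)

removeAt-zipWith : ∀ {A B C : Set} {k} (f : A → B → C) (x : Vec A (suc k)) y j →
                   removeAt (zipWith f x y) j ≡ zipWith f (removeAt x j) (removeAt y j)
removeAt-zipWith f (a ∷ x) (b ∷ y) zero = refl
removeAt-zipWith f (a ∷ x@(_ ∷ _)) (b ∷ y@(_ ∷ _)) (suc j) = cong (f a b ∷_) (removeAt-zipWith f x y j)

removeAt-pencil : ∀ {k n} (A B : Vec (V (suc k)) n) j →
                  Vec.map (λ r → removeAt r j) (pencil A B) ≡
                  pencil (Vec.map (λ r → removeAt r j) A) (Vec.map (λ r → removeAt r j) B)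
removeAt-pencil [] [] j = refl
removeAt-pencil (a ∷ A) (b ∷ B) j = cong₂ _∷_ (removeAt-zipWith linear a b j) (removeAt-pencil A B j)

laplace : ∀ {k} → Vec Poly (suc k) → Vec (Vec Poly (suc k)) k → Fin (suc k) → Poly
laplace row rows j = lookup row j ⊗ det (Vec.map (λ r → removeAt r j) rows)

coeff-det-pencil : ∀ {k} a b (A B : Vec (V (suc k)) k) i →
  coeff (det (pencil (a ∷ A) (b ∷ B))) (suc i) ≡
  sum₂ (λ j → let p = det (pencil (Vec.map (λ r → removeAt r j) A) (Vec.map (λ r → removeAt r j) B)) in
              (lookup a j ∧ coeff p (suc i)) xor (lookup b j ∧ coeff p i))
coeff-det-pencil a b A B i = trans (coeff-sumFin (laplace (zipWith linear a b) (pencil A B)) (suc i)) (sum₂-cong λ j →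
  trans (cong₂ (λ q M → coeff (q ⊗ det M) (suc i)) (lookup-zipWith linear j a b) (removeAt-pencil A B j))
    (coeff-linear-mul (lookup a j) (lookup b j) _ i))

det-pencil-bound : ∀ {k} (A B : Mat Bool k) i → k < i → coeff (det (pencil A B)) i ≡ false
det-pencil-bound [] [] (suc i) lt = refl
det-pencil-bound {suc k} (a ∷ A) (b ∷ B) (suc i) (s≤s lt) =
  trans (coeff-det-pencil a b A B i) (sum₂-zero _ λ j →
    cong₂ _xor_
      (trans (cong (lookup a j ∧_) (det-pencil-bound (minor A j) (minor B j) (suc i) (m≤n⇒m≤1+n lt))) (∧-zeroʳ _))
      (trans (cong (lookup b j ∧_) (det-pencil-bound (minor A j) (minor B j) i lt)) (∧-zeroʳ _)))
  where
  minor : Vec (V (suc k)) k → Fin (suc k) → Mat Bool k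
  minor M j = Vec.map (λ r → removeAt r j) M

det-pencil-lead : ∀ {k} (A B : Mat Bool k) → coeff (det (pencil A B)) k ≡ det₂ B
det-pencil-lead [] [] = refl
det-pencil-lead {suc k} (a ∷ A) (b ∷ B) =
  trans (coeff-det-pencil a b A B k) (sum₂-cong λ j →
    cong₂ _xor_
      (trans (cong (lookup a j ∧_) (det-pencil-bound (minor A j) (minor B j) (suc k) ≤-refl)) (∧-zeroʳ _))
      (cong (lookup b j ∧_) (det-pencil-lead (minor A j) (minor B j))))
  where
  minor : Vec (V (suc k)) k → Fin (suc k) → Mat Bool k
  minor M j = Vec.map (λ r → removeAt r j) M

det₂-identity : ∀ k → det₂ (tabulate {n = k} unit) ≡ true
det₂-identity zero = refl
det₂-identity (suc k) = cong₂ _xor_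
  (trans (cong det₂ (sym (tabulate-∘ (λ r → removeAt r zero) shifted))) (det₂-identity k))
  (sum₂-zero {k} cofactor λ j → cong (_∧ det₂ (Vec.map (λ r → removeAt r (suc j)) (tabulate shifted)))
    (lookup-replicate j false))
  where
  shifted : Fin k → V (suc k)
  shifted = unit ∘ suc
  cofactor : Fin k → Bool
  cofactor j = lookup (0ᵥ {k}) j ∧ det₂ (Vec.map (λ r → removeAt r (suc j)) (tabulate shifted))

charPoly-pencil : ∀ {k} (T : Mat Bool k) → charPoly T ≡ det (pencil T (tabulate unit))
charPoly-pencil {k} T = cong det (lemma id T)
  where
  row : ∀ {k} (t : V k) (e : Fin k → Bool) →
        tabulate (λ j → linear (lookup t j) (e j)) ≡ zipWith linear t (tabulate e)
  row [] e = refl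
  row (a ∷ t) e = cong (linear a (e zero) ∷_) (row t (e ∘ suc))
  lemma : ∀ {n} (ι : Fin n → Fin k) (T : Vec (V k) n) →
          tabulate (λ i → tabulate λ j → linear (lookup (lookup T i) j) (δ (ι i) j)) ≡
          pencil T (tabulate (unit ∘ ι))
  lemma ι [] = refl
  lemma ι (t ∷ T) = cong₂ _∷_
    (trans (row t (δ (ι zero))) (cong (zipWith linear t) (tabulate-δ (ι zero)))) (lemma (ι ∘ suc) T)

charMat : ∀ {k} → Mat Bool k → Mat Poly k
charMat T = tabulate λ i → tabulate λ j → linear (lookup (lookup T i) j) (δ i j)

normalize-det : ∀ {k} (M : Mat Poly k) → normalize (det M) ≡ det M
normalize-det [] = refl
normalize-det {suc k} (row ∷ rows) =
  normalize-idem (addRaw (laplace row rows zero) (sumFin (laplace row rows ∘ suc)))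

charPoly-monic : ∀ {k} (T : Mat Bool k) → ∃ λ u → charPoly T ≡ toList {n = k} u ∷ʳ true
charPoly-monic {k} T = pad k (charPoly T) , monic-form k (charPoly T) (normalize-det (charMat T))
  (trans (cong (λ p → coeff p k) (charPoly-pencil T)) (trans (det-pencil-lead T (tabulate unit)) (det₂-identity k)))
  (λ i lt → trans (cong (λ p → coeff p i) (charPoly-pencil T)) (det-pencil-bound T (tabulate unit) i lt))

-- The ring F₂[X]/(f)

shift : ∀ {k} → Bool → V k → V k
shift b [] = []
shift b (a ∷ u) = b ∷ shift a u

carry : ∀ {k} → Bool → V k → Bool
carry b [] = b
carry b (a ∷ u) = carry a u

shift-carry : ∀ {k} b (u : V k) → toList (shift b u) ∷ʳ carry b u ≡ b ∷ toList u
shift-carry b [] = refl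
shift-carry b (a ∷ u) = cong (b ∷_) (shift-carry a u)

shift-⊞ : ∀ {k} a b (u v : V k) → shift (a xor b) (u ⊞ v) ≡ shift a u ⊞ shift b v
shift-⊞ a b [] [] = refl
shift-⊞ a b (c ∷ u) (d ∷ v) = cong ((a xor b) ∷_) (shift-⊞ c d u v)

carry-⊞ : ∀ {k} a b (u v : V k) → carry (a xor b) (u ⊞ v) ≡ carry a u xor carry b v
carry-⊞ a b [] [] = refl
carry-⊞ a b (c ∷ u) (d ∷ v) = carry-⊞ c d u v

-- Elements are vectors of coefficients, and fv holds the lower coefficients of the monic f.
module Companion {e : ℕ} (fv : V (suc e)) where

  f : Poly
  f = toList fv ∷ʳ true

  K : Set
  K = V (suc e)

  1ₖ : K
  1ₖ = true ∷ 0ᵥ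

  -- Multiplication by X: the coefficient pushed out at the top returns as a multiple of `fv`,
  -- because in characteristic two the leading power of f equals `fv` modulo f.
  S : K → K
  S u = shift false u ⊞ carry false u · fv

  S-⊞ : Additive S
  S-⊞ u v = trans
    (cong₂ _⊞_ (shift-⊞ false false u v)
      (trans (cong (_· fv) (carry-⊞ false false u v)) (·-distribʳ (carry false u) (carry false v) fv)))
    (medial _ _ _ _)

  reduce : Poly → K
  reduce p = act S p 1ₖ

  module _ {k} {T : V k → V k} (T-⊞ : Additive T) where

    act-1ₖ : ∀ v → act T (toList 1ₖ) v ≡ v
    act-1ₖ v = trans (cong (λ w → v ⊞ T w) (trans (sym (comb-orbit T-⊞ (0ᵥ {e}) v)) (comb-0 (orbit T v e))))
      (trans (cong (v ⊞_) (additive-0 T-⊞)) (⊞-identityʳ v))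

    module _ (v : V k) (f-v : act T f v ≡ 0ᵥ) where

      -- Since f(T) v = 0, the top power of T on v may be replaced by `fv`. Hence evaluation u ↦
      -- u(T) v respects reduction modulo f.
      act-S : ∀ u → act T (toList (S u)) v ≡ T (act T (toList u) v)
      act-S u = begin
        ev (shift false u ⊞ carry false u · fv)
          ≡⟨ ev-⊞ (shift false u) (carry false u · fv) ⟩
        ev (shift false u) ⊞ ev (carry false u · fv)
          ≡⟨ cong (ev (shift false u) ⊞_) (trans (additive-· ev-⊞ (carry false u) fv) (cong (carry false u ·_) top-power)) ⟩
        ev (shift false u) ⊞ carry false u · iter T (length (toList (shift false u))) v
          ≡⟨ act-∷ʳ T-⊞ (toList (shift false u)) (carry false u) v ⟨
        act T (toList (shift false u) ∷ʳ carry false u) v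
          ≡⟨ cong (λ p → act T p v) (shift-carry false u) ⟩
        0ᵥ ⊞ T (ev u)
          ≡⟨ ⊞-identityˡ _ ⟩
        T (ev u) ∎
        where
        open ≡-Reasoning
        ev : K → V k
        ev w = act T (toList w) v
        ev-⊞ : Additive ev
        ev-⊞ w w′ = act-toList-⊞ T-⊞ w w′ v
        top-power : ev fv ≡ iter T (length (toList (shift false u))) v
        top-power = trans (⊞≡0⇒≡ _ _ (trans (sym (act-∷ʳ T-⊞ (toList fv) true v)) f-v))
          (cong (λ i → iter T i v) (trans (length-toList fv) (sym (length-toList (shift false u)))))

      act-reduce : ∀ p → act T (toList (reduce p)) v ≡ act T p v
      act-reduce p = trans
        (act-intertwine {φ = λ w → act T (toList w) v} (λ w w′ → act-toList-⊞ T-⊞ w w′ v) act-S p 1ₖ)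
        (cong (act T p) (act-1ₖ v))

  shift-pad : ∀ e b p → shift b (pad (suc e) p) ≡ b ∷ pad e p
  shift-pad zero b [] = refl
  shift-pad zero b (a ∷ p) = refl
  shift-pad (suc e) b [] = cong (b ∷_) (shift-pad e false [])
  shift-pad (suc e) b (a ∷ p) = cong (b ∷_) (shift-pad e a p)

  carry-pad : ∀ e b p → length p ≤ e → carry b (pad (suc e) p) ≡ false
  carry-pad zero b [] le = refl
  carry-pad (suc e) b [] le = carry-pad e false [] z≤n
  carry-pad (suc e) b (a ∷ p) (s≤s le) = carry-pad e a p le

  -- No coefficient is carried while the degree stays below that of f.
  reduce-pad : ∀ p → length p ≤ suc e → reduce p ≡ pad (suc e) p
  reduce-pad [] le = sym (pad-[] (suc e))
  reduce-pad (a ∷ p) (s≤s le) = begin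
    a · 1ₖ ⊞ S (reduce p)
      ≡⟨ cong (λ u → a · 1ₖ ⊞ S u) (reduce-pad p (m≤n⇒m≤1+n le)) ⟩
    a · 1ₖ ⊞ (shift false (pad (suc e) p) ⊞ carry false (pad (suc e) p) · fv)
      ≡⟨ cong₂ (λ u b → a · 1ₖ ⊞ (u ⊞ b · fv)) (shift-pad e false p) (carry-pad e false p le) ⟩
    a · 1ₖ ⊞ ((false ∷ pad e p) ⊞ 0ᵥ)
      ≡⟨ cong₂ _⊞_ (·-∷ a true 0ᵥ) (⊞-identityʳ (false ∷ pad e p)) ⟩
    ((a ∧ true) xor false) ∷ (a · 0ᵥ ⊞ pad e p)
      ≡⟨ cong₂ _∷_ (trans (xor-identityʳ _) (∧-identityʳ a))
           (trans (cong (_⊞ pad e p) (·-zeroʳ a)) (⊞-identityˡ _)) ⟩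
    a ∷ pad e p ∎
    where
    open ≡-Reasoning

  reduce-toList : ∀ u → reduce (toList u) ≡ u
  reduce-toList u = trans (reduce-pad (toList u) (≤-reflexive (length-toList u))) (pad-toList u)

  f-1ₖ : reduce f ≡ 0ᵥ
  f-1ₖ = begin
    reduce (toList fv ∷ʳ true)
      ≡⟨ act-∷ʳ S-⊞ (toList fv) true 1ₖ ⟩
    reduce (toList fv) ⊞ iter S (length (toList fv)) 1ₖ
      ≡⟨ cong₂ (λ u i → u ⊞ iter S i 1ₖ) (reduce-toList fv) (length-toList fv) ⟩
    fv ⊞ S (iter S e 1ₖ)
      ≡⟨ cong (λ u → fv ⊞ S u) (trans (sym (act-Xpow S-⊞ e 1ₖ)) (reduce-pad (Xpow e) (length-Xpow e))) ⟩
    fv ⊞ (shift false (pad (suc e) (Xpow e)) ⊞ carry false (pad (suc e) (Xpow e)) · fv)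
      ≡⟨ cong₂ (λ u b → fv ⊞ (u ⊞ b · fv))
           (trans (shift-pad e false (Xpow e)) (cong (false ∷_) (pad-Xpow e))) (carry-Xpow e false) ⟩
    fv ⊞ (0ᵥ ⊞ fv)
      ≡⟨ ≡⇒⊞≡0 (sym (⊞-identityˡ fv)) ⟩
    0ᵥ ∎
    where
    open ≡-Reasoning
    length-Xpow : ∀ e → length (Xpow e) ≤ suc e
    length-Xpow zero = ≤-refl
    length-Xpow (suc e) = s≤s (length-Xpow e)
    pad-Xpow : ∀ e → pad e (Xpow e) ≡ 0ᵥ
    pad-Xpow zero = refl
    pad-Xpow (suc e) = cong (false ∷_) (pad-Xpow e)
    carry-Xpow : ∀ e b → carry b (pad (suc e) (Xpow e)) ≡ true
    carry-Xpow zero b = refl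
    carry-Xpow (suc e) b = carry-Xpow e false

  -- Each v is v(S) applied to `1ₖ`, and f(S) commutes with v(S).
  f-S : ∀ v → act S f v ≡ 0ᵥ
  f-S v = begin
    act S f v                     ≡⟨ cong (act S f) (reduce-toList v) ⟨
    act S f (act S (toList v) 1ₖ) ≡⟨ act-comm S-⊞ f (toList v) 1ₖ ⟩
    act S (toList v) (reduce f)   ≡⟨ cong (act S (toList v)) f-1ₖ ⟩
    act S (toList v) 0ᵥ           ≡⟨ additive-0 (act-additive S-⊞ (toList v)) ⟩
    0ᵥ                            ∎
    where open ≡-Reasoning

  infixl 7 _⊛_

  _⊛_ : K → K → K
  u ⊛ v = act S (toList u) v

  θ : K
  θ = S 1ₖ

  ⊛-additiveʳ : ∀ u → Additive (u ⊛_)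
  ⊛-additiveʳ u = act-additive S-⊞ (toList u)

  ⊛-additiveˡ : ∀ v → Additive (_⊛ v)
  ⊛-additiveˡ v u w = act-toList-⊞ S-⊞ u w v

  ⊛-identityˡ : ∀ u → 1ₖ ⊛ u ≡ u
  ⊛-identityˡ = act-1ₖ S-⊞

  ⊛-comm : ∀ u v → u ⊛ v ≡ v ⊛ u
  ⊛-comm u v = begin
    act S (toList u) v                      ≡⟨ cong (act S (toList u)) (reduce-toList v) ⟨
    act S (toList u) (act S (toList v) 1ₖ)  ≡⟨ act-comm S-⊞ (toList u) (toList v) 1ₖ ⟩
    act S (toList v) (act S (toList u) 1ₖ)  ≡⟨ cong (act S (toList v)) (reduce-toList u) ⟩
    act S (toList v) u                      ∎
    where open ≡-Reasoning

  ⊛-identityʳ : ∀ u → u ⊛ 1ₖ ≡ u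
  ⊛-identityʳ u = trans (⊛-comm u 1ₖ) (⊛-identityˡ u)

  S-⊛ : ∀ u v → S u ⊛ v ≡ S (u ⊛ v)
  S-⊛ u v = act-S S-⊞ v (f-S v) u

  ⊛-assoc : ∀ u v w → (u ⊛ v) ⊛ w ≡ u ⊛ (v ⊛ w)
  ⊛-assoc u v w = act-intertwine {φ = _⊛ w} (⊛-additiveˡ w) (λ x → S-⊛ x w) (toList u) v

  ⊛-zeroʳ : ∀ u → u ⊛ 0ᵥ ≡ 0ᵥ
  ⊛-zeroʳ u = additive-0 (⊛-additiveʳ u)

  ⊛-zeroˡ : ∀ u → 0ᵥ ⊛ u ≡ 0ᵥ
  ⊛-zeroˡ u = additive-0 (⊛-additiveˡ u)

  ⊛-interchange : ∀ a b c d → (a ⊛ b) ⊛ (c ⊛ d) ≡ (a ⊛ c) ⊛ (b ⊛ d)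
  ⊛-interchange a b c d = begin
    (a ⊛ b) ⊛ (c ⊛ d)  ≡⟨ ⊛-assoc a b (c ⊛ d) ⟩
    a ⊛ (b ⊛ (c ⊛ d))  ≡⟨ cong (a ⊛_) (⊛-assoc b c d) ⟨
    a ⊛ ((b ⊛ c) ⊛ d)  ≡⟨ cong (λ x → a ⊛ (x ⊛ d)) (⊛-comm b c) ⟩
    a ⊛ ((c ⊛ b) ⊛ d)  ≡⟨ cong (a ⊛_) (⊛-assoc c b d) ⟩
    a ⊛ (c ⊛ (b ⊛ d))  ≡⟨ ⊛-assoc a c (b ⊛ d) ⟨
    (a ⊛ c) ⊛ (b ⊛ d)  ∎
    where open ≡-Reasoning

  reduce-mulRaw : ∀ p q → reduce (mulRaw p q) ≡ reduce p ⊛ reduce q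
  reduce-mulRaw p q = trans (act-mul S-⊞ p q 1ₖ) (sym (act-reduce S-⊞ (reduce q) (f-S (reduce q)) p))

  θ-⊛ : ∀ u → θ ⊛ u ≡ S u
  θ-⊛ u = trans (S-⊛ 1ₖ u) (cong S (⊛-identityˡ u))

  iter-S-⊛ : ∀ k u v → iter S k u ⊛ v ≡ iter S k (u ⊛ v)
  iter-S-⊛ zero u v = refl
  iter-S-⊛ (suc k) u v = trans (S-⊛ (iter S k u) v) (cong S (iter-S-⊛ k u v))

  infix 8 _at_

  _at_ : Poly → K → K
  p at γ = act (γ ⊛_) p 1ₖ

  at-⊛ : ∀ γ p v → p at γ ⊛ v ≡ act (γ ⊛_) p v
  at-⊛ γ p v = trans (act-intertwine {φ = _⊛ v} (⊛-additiveˡ v) (λ x → ⊛-assoc γ x v) p 1ₖ)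
    (cong (act (γ ⊛_) p) (⊛-identityˡ v))

  at-mulRaw : ∀ γ p q → mulRaw p q at γ ≡ p at γ ⊛ q at γ
  at-mulRaw γ p q = trans (act-mul (⊛-additiveʳ γ) p q 1ₖ) (sym (at-⊛ γ p (q at γ)))

  -- As f(T) = 0, `op` turns the space into a module over F₂[X]/(f) on which X acts as `T`.
  module Module {k} {T : V k → V k} (T-⊞ : Additive T) (f-T : ∀ v → act T f v ≡ 0ᵥ) where

    op : K → V k → V k
    op u v = act T (toList u) v

    op-additiveˡ : ∀ v → Additive (λ u → op u v)
    op-additiveˡ v u w = act-toList-⊞ T-⊞ u w v

    op-additiveʳ : ∀ u → Additive (op u)
    op-additiveʳ u = act-additive T-⊞ (toList u)

    op-S : ∀ u v → op (S u) v ≡ T (op u v)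
    op-S u v = act-S T-⊞ v (f-T v) u

    op-⊛ : ∀ u w v → op (u ⊛ w) v ≡ op u (op w v)
    op-⊛ u w v = act-intertwine {φ = λ w → op w v} (op-additiveˡ v) (λ w → op-S w v) (toList u) w

    op-1 : ∀ v → op 1ₖ v ≡ v
    op-1 = act-1ₖ T-⊞

    op-reduce : ∀ p v → op (reduce p) v ≡ act T p v
    op-reduce p v = act-reduce T-⊞ v (f-T v) p

    op-at : ∀ γ p v → op (p at γ) v ≡ act (op γ) p v
    op-at γ p v = trans
      (act-intertwine {φ = λ w → op w v} (op-additiveˡ v) (λ w → op-⊛ γ w v) p 1ₖ)
      (cong (act (op γ) p) (op-1 v))

    op-iter : ∀ n v → op (iter S n 1ₖ) v ≡ iter T n v
    op-iter zero v = op-1 v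
    op-iter (suc n) v = trans (op-S (iter S n 1ₖ) v) (cong T (op-iter n v))

-- Cardinalities

_≟ᵥ_ : ∀ {k} → DecidableEquality (V k)
_≟ᵥ_ = ≡-dec Bool._≟_

unique-⊆⇒length≤ : {A : Set} {xs ys : List A} → Unique xs → (∀ {x} → x ∈ xs → x ∈ ys) → length xs ≤ length ys
unique-⊆⇒length≤ [] sub = z≤n
unique-⊆⇒length≤ {A} {x ∷ xs} (x∉xs ∷ uniq) sub with ∈-∃++ (sub (here refl))
... | as , bs , refl =
  ≤-trans (s≤s (unique-⊆⇒length≤ uniq sub′))
    (≤-reflexive (trans (cong suc (length-++ as)) (trans (sym (+-suc (length as) (length bs))) (sym (length-++ as)))))
  where
  sub′ : ∀ {y} → y ∈ xs → y ∈ as ++ bs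
  sub′ y∈xs with ∈-++⁻ as (sub (there y∈xs))
  ... | inj₁ y∈as = ∈-++⁺ˡ y∈as
  ... | inj₂ (there y∈bs) = ∈-++⁺ʳ as y∈bs
  ... | inj₂ (here refl) = contradiction refl (All.lookup x∉xs y∈xs)

card-unique : {A : Set} {P : A → Set} {M N : ℕ} → HasCard P M → HasCard P N → M ≡ N
card-unique (L , uniq , mem , refl) (L′ , uniq′ , mem′ , refl) = ≤-antisym
  (unique-⊆⇒length≤ uniq (λ {x} → from (mem′ x) ∘ to (mem x)))
  (unique-⊆⇒length≤ uniq′ (λ {x} → from (mem x) ∘ to (mem′ x)))

-- A bijection presented as a relation, so that neither map has to be defined outside `P` and `Q` or
-- be shown independent of the membership proofs.
card-rel : {A B : Set} {P : A → Set} {Q : B → Set} (R : A → B → Set) →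
           (∀ a → P a → ∃ λ b → Q b × R a b) → (∀ b → Q b → ∃ λ a → P a × R a b) →
           (∀ {a a′ b} → R a b → R a′ b → a ≡ a′) → (∀ {a b b′} → R a b → R a b′ → b ≡ b′) →
           ∀ {N} → HasCard P N → HasCard Q N
card-rel {A} {B} {P} {Q} R fwd bwd inj fun (L , uniq , mem , refl) = result (transport L (λ a → to (mem a)))
  where
  transport : ∀ L → (∀ a → a ∈ L → P a) → ∃ λ L′ → Pointwise R L L′ × All Q L′
  transport [] _ = [] , [] , []
  transport (a ∷ L) LP with fwd a (LP a (here refl)) | transport L (λ a → LP a ∘ there)
  ... | b , Qb , Rab | L′ , rs , qs = b ∷ L′ , Rab ∷ rs , Qb ∷ qs
  image : ∀ {L L′ a} → Pointwise R L L′ → a ∈ L → ∃ λ b → b ∈ L′ × R a b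
  image (r ∷ rs) (here refl) = _ , here refl , r
  image (r ∷ rs) (there a∈L) with image rs a∈L
  ... | b , b∈L′ , r′ = b , there b∈L′ , r′
  preimage : ∀ {L L′ b} → Pointwise R L L′ → b ∈ L′ → ∃ λ a → a ∈ L × R a b
  preimage (r ∷ rs) (here refl) = _ , here refl , r
  preimage (r ∷ rs) (there b∈L′) with preimage rs b∈L′
  ... | a , a∈L , r′ = a , there a∈L , r′
  unique′ : ∀ {L L′} → Pointwise R L L′ → Unique L → Unique L′
  unique′ [] [] = []
  unique′ (r ∷ rs) (a∉ ∷ u) = All.tabulate apart ∷ unique′ rs u
    where
    apart : ∀ {y} → y ∈ _ → _ ≢ y
    apart y∈ refl with preimage rs y∈
    ... | a , a∈L , r′ = All.lookup a∉ a∈L (inj r r′)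
  result : (∃ λ L′ → Pointwise R L L′ × All Q L′) → HasCard Q (length L)
  result (L′ , rs , qs) = L′ , unique′ rs uniq , (λ b → mk⇔ (All.lookup qs) member) , sym (Pointwise-length rs)
    where
    member : ∀ {b} → Q b → b ∈ L′
    member Qb with bwd _ Qb
    ... | a , Pa , Rab with image rs (from (mem a) Pa)
    ... | b′ , b′∈L′ , Rab′ = subst (_∈ L′) (fun Rab′ Rab) b′∈L′

card-fibre : {A B : Set} {P : A → Set} {Q : B → Set} (π : B → A) → (∀ b → Q b → P (π b)) →
             ∀ {M N} → HasCard P N → (∀ a → P a → HasCard (λ b → Q b × π b ≡ a) M) → HasCard Q (N * M)
card-fibre {A} {B} {P} {Q} π proj {M} (L , uniq , mem , refl) fibre =
  result (build L uniq (λ a → to (mem a)))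
  where
  build : ∀ L → Unique L → (∀ a → a ∈ L → P a) → HasCard (λ b → Q b × π b ∈ L) (length L * M)
  build [] _ _ = [] , [] , (λ b → mk⇔ (λ ()) (λ { (_ , ()) })) , refl
  build (a ∷ L) (a∉L ∷ uniq) LP with fibre a (LP a (here refl)) | build L uniq (λ a → LP a ∘ there)
  ... | F , uniqF , memF , lenF | G , uniqG , memG , lenG =
    F ++ G ,
    Unique.++⁺ uniqF uniqG
      (λ {x} (x∈F , x∈G) → All.lookup a∉L (proj₂ (to (memG x) x∈G)) (sym (proj₂ (to (memF x) x∈F)))) ,
    (λ b → mk⇔ (split b) (join b)) ,
    trans (length-++ F) (cong₂ _+_ lenF lenG)
    where
    split : ∀ b → b ∈ F ++ G → Q b × π b ∈ a ∷ L
    split b b∈ with ∈-++⁻ F b∈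
    ... | inj₁ b∈F = proj₁ (to (memF b) b∈F) , here (proj₂ (to (memF b) b∈F))
    ... | inj₂ b∈G = proj₁ (to (memG b) b∈G) , there (proj₂ (to (memG b) b∈G))
    join : ∀ b → Q b × π b ∈ a ∷ L → b ∈ F ++ G
    join b (Qb , here eq) = ∈-++⁺ˡ (from (memF b) (Qb , eq))
    join b (Qb , there πb∈L) = ∈-++⁺ʳ F (from (memG b) (Qb , πb∈L))
  result : HasCard (λ b → Q b × π b ∈ L) (length L * M) → HasCard Q (length L * M)
  result (G , uniqG , memG , lenG) =
    G , uniqG , (λ b → mk⇔ (proj₁ ∘ to (memG b)) (λ Qb → from (memG b) (Qb , from (mem (π b)) (proj b Qb)))) , lenG

length-filter-split : {A : Set} {P : A → Set} (P? : Decidable P) → ∀ L →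
                      length (filter P? L) + length (filter (λ a → ¬? (P? a)) L) ≡ length L
length-filter-split P? [] = refl
length-filter-split P? (a ∷ L) with P? a
... | yes _ = cong suc (length-filter-split P? L)
... | no _ = trans (+-suc _ _) (cong suc (length-filter-split P? L))

card-complement : {A : Set} (_≟_ : DecidableEquality A) {P : A → Set} {N K : ℕ} →
                  HasCard {A} (λ _ → ⊤) N → HasCard P K → HasCard (λ a → ¬ P a) (N ∸ K)
card-complement {A} _≟_ {P} (L , uniq , mem , refl) cardP@(LP , uniqP , memP , lenP) =
  filter (λ a → ¬? (P? a)) L , Unique.filter⁺ (λ a → ¬? (P? a)) uniq ,
  (λ a → mk⇔ (proj₂ ∘ ∈-filter⁻ (λ a → ¬? (P? a)) {xs = L}) (∈-filter⁺ (λ a → ¬? (P? a)) (from (mem a) tt))) ,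
  trans (sym (m+n∸m≡n (length (filter P? L)) _)) (cong₂ _∸_ (length-filter-split P? L) lenP′)
  where
  P? : Decidable P
  P? a = map′ (to (memP a)) (from (memP a)) (any? (a ≟_) LP)
  lenP′ : length (filter P? L) ≡ _
  lenP′ = card-unique {P = P}
    (filter P? L , Unique.filter⁺ P? uniq ,
      (λ a → mk⇔ (proj₂ ∘ ∈-filter⁻ P? {xs = L}) (∈-filter⁺ P? (from (mem a) tt))) , refl)
    cardP

card-V : ∀ k → HasCard {V k} (λ _ → ⊤) (2 ^ k)
card-V zero = [] ∷ [] , [] ∷ [] , (λ { [] → mk⇔ _ (λ _ → here refl) }) , refl
card-V (suc k) = card-fibre head _ card-Bool λ a _ →
  card-rel (λ v w → w ≡ a ∷ v) (λ v _ → a ∷ v , (tt , refl) , refl)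
    (λ { (_ ∷ v) (_ , refl) → v , tt , refl }) (λ { refl refl → refl }) (λ { refl refl → refl }) (card-V k)
  where
  card-Bool : HasCard {Bool} (λ _ → ⊤) 2
  card-Bool = true ∷ false ∷ [] , ((λ ()) ∷ []) ∷ [] ∷ [] ,
    (λ { true → mk⇔ _ (λ _ → here refl) ; false → mk⇔ _ (λ _ → there (here refl)) }) , refl

exhausting⇒length≥ : ∀ {k} (vs : List (V k)) → (∀ v → v ∈ vs) → 2 ^ k ≤ length vs
exhausting⇒length≥ {k} vs complete with card-V k
... | L , uniq , mem , len = subst (_≤ length vs) len (unique-⊆⇒length≤ uniq (λ {x} _ → complete x))

abstract

  -- A missed vector put in front of the image would give 2ᵏ + 1 distinct vectors. Being abstract,
  -- this keeps inverses and coordinates from unfolding into a search through all vectors.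
  injective⇒surjective : ∀ {k} (T : V k → V k) → (∀ {u v} → T u ≡ T v → u ≡ v) → ∀ v → ∃ λ u → T u ≡ v
  injective⇒surjective {k} T inj v with card-V k
  ... | L , uniq , mem , len with any? (v ≟ᵥ_) (List.map T L)
  ...   | yes v∈ = let u , _ , eq = ∈-map⁻ T v∈ in u , sym eq
  ...   | no v∉ = contradiction
    (≤-trans (s≤s (≤-reflexive (sym (length-map T L))))
      (unique-⊆⇒length≤ (¬Any⇒All¬ _ v∉ ∷ Unique.map⁺ inj uniq) (λ {x} _ → from (mem x) tt)))
    1+n≰n

-- Extending independent families

Independent : ∀ {i m} → Vec (V m) i → Set
Independent bs = ∀ w → comb w bs ≡ 0ᵥ → w ≡ 0ᵥ

-- The old vectors `bs` and the new vectors `cs` are jointly independent. They are kept apart so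
-- that the induction can move one vector at a time from `cs` to `bs`.
Extends : ∀ {i m} → Vec (V m) i → ∀ {k} → Vec (V m) k → Set
Extends bs cs = ∀ u w → comb u cs ⊞ comb w bs ≡ 0ᵥ → u ≡ 0ᵥ × w ≡ 0ᵥ

-- Each factor counts the vectors of F₂ᵐ outside the span of the i independent ones already chosen.
extensions : ℕ → ℕ → ℕ → ℕ
extensions m i zero = 1
extensions m i (suc k) = (2 ^ m ∸ 2 ^ i) * extensions m (suc i) k

InSpan : ∀ {i m} → Vec (V m) i → V m → Set
InSpan bs v = ∃ λ w → v ≡ comb w bs

card-span : ∀ {i m} (bs : Vec (V m) i) → Independent bs → HasCard (InSpan bs) (2 ^ i)
card-span bs ind = card-rel (λ w v → v ≡ comb w bs) (λ w _ → comb w bs , (w , refl) , refl)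
  (λ { v (w , eq) → w , tt , eq })
  (λ eq eq′ → additive-injective (comb-additive bs) ind (trans (sym eq) eq′))
  (λ eq eq′ → trans eq (sym eq′)) (card-V _)

independent-∷ : ∀ {i m} (b : V m) (bs : Vec (V m) i) → Independent bs → ¬ InSpan bs b → Independent (b ∷ bs)
independent-∷ b bs ind b∉ (true ∷ w) eq = contradiction (w , ⊞≡0⇒≡ b (comb w bs) eq) b∉
independent-∷ b bs ind b∉ (false ∷ w) eq = cong (false ∷_) (ind w (trans (sym (⊞-identityˡ _)) eq))

-- Fibred over the first new vector: it avoids the span of `bs`, and once it has joined `bs`, the
-- number of continuations depends only on the number of vectors.
card-extensions : ∀ {i m} k (bs : Vec (V m) i) → Independent bs → HasCard (Extends bs {k}) (extensions m i k)
card-extensions zero bs ind = [] ∷ [] , [] ∷ [] ,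
  (λ { [] → mk⇔ (λ _ → λ { [] w eq → refl , ind w (trans (sym (⊞-identityˡ _)) eq) }) (λ _ → here refl) }) , refl
card-extensions {i} {m} (suc k) bs ind = card-fibre {P = λ c → ¬ InSpan bs c} {Q = Extends bs {suc k}} head outside
  (card-complement _≟ᵥ_ (card-V m) (card-span bs ind))
  λ c c∉ → card-rel (λ cs cs′ → cs′ ≡ c ∷ cs)
    (λ cs ext → c ∷ cs , (swap c cs ext , refl) , refl)
    (λ { (_ ∷ cs) (ext , refl) → cs , swap′ c cs ext , refl })
    (λ { refl refl → refl }) (λ { refl refl → refl })
    (card-extensions k (c ∷ bs) (independent-∷ c bs ind c∉))
  where
  outside : ∀ cs → Extends bs {suc k} cs → ¬ InSpan bs (head cs)
  outside (c ∷ cs) ext (w , eq) with ext (true ∷ 0ᵥ) w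
    (≡⇒⊞≡0 (trans (trans (cong (c ⊞_) (comb-0 cs)) (⊞-identityʳ c)) eq))
  ... | () , _
  regroup : ∀ a (c : V m) u cs w → comb (a ∷ u) (c ∷ cs) ⊞ comb w bs ≡ comb u cs ⊞ comb (a ∷ w) (c ∷ bs)
  regroup a c u cs w = ⊞-solve (a · c ∷ comb u cs ∷ comb w bs ∷ []) (x₀ :+ x₁ :+ x₂) (x₁ :+ (x₀ :+ x₂)) refl
  swap : ∀ c (cs : Vec (V m) k) → Extends (c ∷ bs) cs → Extends bs (c ∷ cs)
  swap c cs ext (a ∷ u) w eq with ext u (a ∷ w) (trans (sym (regroup a c u cs w)) eq)
  ... | refl , refl = refl , refl
  swap′ : ∀ c (cs : Vec (V m) k) → Extends bs (c ∷ cs) → Extends (c ∷ bs) cs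
  swap′ c cs ext u (a ∷ w) eq with ext (a ∷ u) w (trans (regroup a c u cs w) eq)
  ... | refl , refl = refl , refl

extensions≡prodGL : ∀ m → extensions (suc m) 1 m ≡ prodGL (suc m)
extensions≡prodGL m = sym (trans (cong product (map-applyUpTo suc (λ i → 2 ^ suc m ∸ 2 ^ i) m))
  (lemma m 1 _ (λ _ → refl)))
  where
  -- `g` is arbitrary because `applyUpTo` shifts its function at every step.
  lemma : ∀ k i (g : ℕ → ℕ) → (∀ x → g x ≡ 2 ^ suc m ∸ 2 ^ (i + x)) → product (applyUpTo g k) ≡ extensions (suc m) i k
  lemma zero i g eq = refl
  lemma (suc k) i g eq = cong₂ _*_ (trans (eq 0) (cong (λ j → 2 ^ suc m ∸ 2 ^ j) (+-identityʳ i)))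
    (lemma k (suc i) (g ∘ suc) (λ x → trans (eq (suc x)) (cong (λ j → 2 ^ suc m ∸ 2 ^ j) (+-suc i x))))

-- The field of a primitive polynomial

module Field {e : ℕ} (fv : V (suc (suc e))) (gen : RootGenerates (toList fv ∷ʳ true)) where

  open Companion fv public

  -- Degree at least two excludes f = X, for which `RootGenerates` holds although the root is 0.
  d : ℕ
  d = suc (suc e)

  abstract
    -- `RootGenerates` gives f ∣ Xᵏ + u as polynomials, so one exponent serves every operator
    -- annihilated by f: `S`, the TSR matrices, and the zero operator in the argument about the
    -- constant term.
    power : ∀ (u : K) → u ≢ 0ᵥ → ∃ λ k → ∀ {j} {T : V j → V j} → Additive T → (∀ v → act T f v ≡ 0ᵥ) →
            ∀ v → act T (toList u) v ≡ iter T k v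
    power u u≢0 with gen (normalize (toList u)) (normalize-idem (toList u)) nonzero small
      where
      nonzero : normalize (toList u) ≢ []
      nonzero eq = u≢0 (trans (sym (reduce-toList u))
        (trans (sym (act-normalize S-⊞ (toList u) 1ₖ)) (cong reduce eq)))
      deg-f : deg f ≡ d
      deg-f = trans (cong (λ p → length p ∸ 1) (normalize-∷ʳ (toList fv)))
        (trans (cong (_∸ 1) (length-++ (toList fv))) (trans (ℕ.m+n∸n≡m (length (toList fv)) 1) (length-toList fv)))
      small : deg (normalize (toList u)) < deg f
      small = subst (deg (normalize (toList u)) <_) (sym deg-f) (s≤s (ℕ.∸-monoˡ-≤ 1
        (≤-trans (length-normalize (normalize (toList u)))
          (≤-trans (length-normalize (toList u)) (≤-reflexive (length-toList u))))))
    ... | k , q , eq = k , λ {_} {T} T-⊞ f-T v → sym (⊞≡0⇒≡ _ _ (begin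
      iter T k v ⊞ act T (toList u) v
        ≡⟨ cong₂ _⊞_ (act-Xpow T-⊞ k v) (act-normalize T-⊞ (toList u) v) ⟨
      act T (Xpow k) v ⊞ act T (normalize (toList u)) v
        ≡⟨ act-⊕ T-⊞ (Xpow k) (normalize (toList u)) v ⟨
      act T (Xpow k ⊕ normalize (toList u)) v
        ≡⟨ act-normalize T-⊞ (Xpow k ⊕ normalize (toList u)) v ⟨
      act T (normalize (Xpow k ⊕ normalize (toList u))) v
        ≡⟨ cong (λ p → act T p v) eq ⟨
      act T (q ⊗ f) v
        ≡⟨ trans (act-⊗ T-⊞ q f v) (cong (act T q) (f-T v)) ⟩
      act T q 0ᵥ
        ≡⟨ additive-0 (act-additive T-⊞ q) ⟩
      0ᵥ ∎))
      where open ≡-Reasoning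

  -- If X divided f, the power of X congruent to 1 + X would be 1, by evaluation at 0.
  constant-term : ∃ λ fv′ → fv ≡ true ∷ fv′
  constant-term = case fv refl
    where
    nilpotent : ∀ fv′ → fv ≡ false ∷ fv′ → ∀ v → act {1} (λ _ → 0ᵥ) f v ≡ 0ᵥ
    nilpotent fv′ refl v = refl
    case : ∀ w → fv ≡ w → ∃ λ fv′ → fv ≡ true ∷ fv′
    case (true ∷ fv′) eq = fv′ , eq
    case (false ∷ fv′) eq with power (true ∷ true ∷ 0ᵥ) (λ ())
    ... | zero , pow with trans (sym (reduce-toList (true ∷ true ∷ 0ᵥ))) (pow S-⊞ f-S 1ₖ)
    ...   | ()
    case (false ∷ fv′) eq | suc k , pow with pow {1} {λ _ → 0ᵥ} (λ _ _ → refl) (nilpotent fv′ eq) (true ∷ [])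
    ...   | ()

  module _ {j} {T : V j → V j} (T-⊞ : Additive T) (f-T : ∀ v → act T f v ≡ 0ᵥ) where

    -- As f has constant term 1, f(T) v = 0 writes v as a polynomial in T applied to `T v`.
    operator-ker : ∀ v → T v ≡ 0ᵥ → v ≡ 0ᵥ
    operator-ker v Tv≡0 with constant-term
    ... | fv′ , refl = sym (begin
      0ᵥ                     ≡⟨ f-T v ⟨
      v ⊞ T (act T f′ v)     ≡⟨ cong (v ⊞_) (act-shift T-⊞ f′ v) ⟨
      v ⊞ act T f′ (T v)     ≡⟨ cong (λ w → v ⊞ act T f′ w) Tv≡0 ⟩
      v ⊞ act T f′ 0ᵥ        ≡⟨ cong (v ⊞_) (additive-0 (act-additive T-⊞ f′)) ⟩
      v ⊞ 0ᵥ                 ≡⟨ ⊞-identityʳ v ⟩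
      v                      ∎)
      where
      open ≡-Reasoning
      f′ = toList fv′ ∷ʳ true

    iter-ker : ∀ k v → iter T k v ≡ 0ᵥ → v ≡ 0ᵥ
    iter-ker zero v eq = eq
    iter-ker (suc k) v eq = iter-ker k v (operator-ker (iter T k v) eq)

    -- A nonzero u acts as a power of the injective `T`. With `S` for `T` this says that K has no
    -- zero divisors.
    op-ker : ∀ u → u ≢ 0ᵥ → ∀ v → act T (toList u) v ≡ 0ᵥ → v ≡ 0ᵥ
    op-ker u u≢0 v eq with power u u≢0
    ... | k , pow = iter-ker k v (trans (sym (pow T-⊞ f-T v)) eq)

    op-faithful : ∀ u v → v ≢ 0ᵥ → act T (toList u) v ≡ 0ᵥ → u ≡ 0ᵥ
    op-faithful u v v≢0 eq with u ≟ᵥ 0ᵥ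
    ... | yes u≡0 = u≡0
    ... | no u≢0 = contradiction (op-ker u u≢0 v eq) v≢0

  ⊛-cancel : ∀ u → u ≢ 0ᵥ → ∀ {v w} → u ⊛ v ≡ u ⊛ w → v ≡ w
  ⊛-cancel u u≢0 = additive-injective (⊛-additiveʳ u) (op-ker S-⊞ f-S u u≢0)

  inverse : ∀ u → u ≢ 0ᵥ → ∃ λ w → u ⊛ w ≡ 1ₖ
  inverse u u≢0 = injective⇒surjective (u ⊛_) (⊛-cancel u u≢0) 1ₖ

  -- Polynomials over K and their roots

  eval : List K → K → K
  eval [] x = 0ᵥ
  eval (a ∷ p) x = a ⊞ x ⊛ eval p x

  -- Synthetic division: the quotient of X p by X − x.
  quot : K → List K → List K
  quot x [] = []
  quot x (b ∷ p) = eval (b ∷ p) x ∷ quot x p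

  length-quot : ∀ x p → length (quot x p) ≡ length p
  length-quot x [] = refl
  length-quot x (b ∷ p) = cong suc (length-quot x p)

  eval-quot : ∀ x p y → y ⊛ eval p y ⊞ x ⊛ eval p x ≡ (y ⊞ x) ⊛ eval (quot x p) y
  eval-quot x [] y = begin
    y ⊛ 0ᵥ ⊞ x ⊛ 0ᵥ  ≡⟨ cong₂ _⊞_ (⊛-zeroʳ y) (⊛-zeroʳ x) ⟩
    0ᵥ ⊞ 0ᵥ          ≡⟨ ⊞-self 0ᵥ ⟩
    0ᵥ               ≡⟨ ⊛-zeroʳ (y ⊞ x) ⟨
    (y ⊞ x) ⊛ 0ᵥ     ∎
    where open ≡-Reasoning
  eval-quot x (b ∷ p) y = begin
    y ⊛ (b ⊞ y ⊛ P) ⊞ x ⊛ (b ⊞ x ⊛ P′)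
      ≡⟨ cong₂ _⊞_ (⊛-additiveʳ y b (y ⊛ P)) (⊛-additiveʳ x b (x ⊛ P′)) ⟩
    y ⊛ b ⊞ y ⊛ (y ⊛ P) ⊞ (x ⊛ b ⊞ x ⊛ (x ⊛ P′))
      ≡⟨ ⊞-solve (y ⊛ b ∷ y ⊛ (y ⊛ P) ∷ x ⊛ b ∷ x ⊛ (x ⊛ P′) ∷ y ⊛ (x ⊛ P′) ∷ [])
           (x₀ :+ x₁ :+ (x₂ :+ x₃)) (x₀ :+ x₄ :+ (x₂ :+ x₃) :+ (x₁ :+ x₄)) refl ⟩
    y ⊛ b ⊞ y ⊛ (x ⊛ P′) ⊞ (x ⊛ b ⊞ x ⊛ (x ⊛ P′)) ⊞ (y ⊛ (y ⊛ P) ⊞ y ⊛ (x ⊛ P′))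
      ≡⟨ cong₂ _⊞_ (cong₂ _⊞_ (⊛-additiveʳ y b (x ⊛ P′)) (⊛-additiveʳ x b (x ⊛ P′)))
           (⊛-additiveʳ y (y ⊛ P) (x ⊛ P′)) ⟨
    y ⊛ B ⊞ x ⊛ B ⊞ y ⊛ (y ⊛ P ⊞ x ⊛ P′)
      ≡⟨ cong₂ _⊞_ (sym (⊛-additiveˡ B y x)) (cong (y ⊛_) (eval-quot x p y)) ⟩
    (y ⊞ x) ⊛ B ⊞ y ⊛ ((y ⊞ x) ⊛ Q)
      ≡⟨ cong ((y ⊞ x) ⊛ B ⊞_) (trans (sym (⊛-assoc y (y ⊞ x) Q))
           (trans (cong (_⊛ Q) (⊛-comm y (y ⊞ x))) (⊛-assoc (y ⊞ x) y Q))) ⟩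
    (y ⊞ x) ⊛ B ⊞ (y ⊞ x) ⊛ (y ⊛ Q)
      ≡⟨ ⊛-additiveʳ (y ⊞ x) B (y ⊛ Q) ⟨
    (y ⊞ x) ⊛ (B ⊞ y ⊛ Q) ∎
    where
    open ≡-Reasoning
    P = eval p y
    P′ = eval p x
    B = b ⊞ x ⊛ P′
    Q = eval (quot x p) y

  Zero : List K → Set
  Zero = All (_≡ 0ᵥ)

  eval-zero : ∀ {p} → Zero p → ∀ x → eval p x ≡ 0ᵥ
  eval-zero [] x = refl
  eval-zero (refl ∷ zs) x = trans (⊞-identityˡ _) (trans (cong (x ⊛_) (eval-zero zs x)) (⊛-zeroʳ x))

  constant-zero : ∀ {b p} x → eval (b ∷ p) x ≡ 0ᵥ → Zero p → b ≡ 0ᵥ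
  constant-zero {b} x eq zs = trans (sym (⊞-identityʳ b))
    (trans (cong (b ⊞_) (sym (trans (cong (x ⊛_) (eval-zero zs x)) (⊛-zeroʳ x)))) eq)

  quot-zero : ∀ x p → Zero (quot x p) → Zero p
  quot-zero x [] [] = []
  quot-zero x (b ∷ p) (eq ∷ zs) = let ps = quot-zero x p zs in constant-zero x eq ps ∷ ps

  -- For roots x ≠ y of b + X p, both x p(x) and y p(y) equal b, so y is a root of the quotient of X
  -- p by X - x, which has one coefficient less.
  root-bound : ∀ p xs → Unique xs → All (λ x → eval p x ≡ 0ᵥ) xs → length p ≤ length xs → Zero p
  root-bound [] xs uniq roots le = []
  root-bound (b ∷ p) (x ∷ xs) (x∉xs ∷ uniq) (root ∷ roots) (s≤s le) = constant-zero x root ps ∷ ps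
    where
    root-quot : ∀ {y} → x ≢ y × eval (b ∷ p) y ≡ 0ᵥ → eval (quot x p) y ≡ 0ᵥ
    root-quot {y} (x≢y , root′) = op-ker S-⊞ f-S (y ⊞ x) (λ eq → x≢y (sym (⊞≡0⇒≡ y x eq))) _ (begin
      (y ⊞ x) ⊛ eval (quot x p) y        ≡⟨ eval-quot x p y ⟨
      y ⊛ eval p y ⊞ x ⊛ eval p x        ≡⟨ cong₂ _⊞_ (⊞≡0⇒≡ b _ root′) (⊞≡0⇒≡ b _ root) ⟨
      b ⊞ b                              ≡⟨ ⊞-self b ⟩
      0ᵥ                                 ∎)
      where open ≡-Reasoning
    ps : Zero p
    ps = quot-zero x p (root-bound (quot x p) xs uniq (All.map root-quot (All.zip (x∉xs , roots)))
      (≤-trans (≤-reflexive (length-quot x p)) le))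

  -- Frobenius and conjugates

  square : K → K
  square x = x ⊛ x

  frob : ℕ → K → K
  frob = iter square

  square-⊞ : Additive square
  square-⊞ x y = begin
    (x ⊞ y) ⊛ (x ⊞ y)                    ≡⟨ ⊛-additiveˡ (x ⊞ y) x y ⟩
    x ⊛ (x ⊞ y) ⊞ y ⊛ (x ⊞ y)            ≡⟨ cong₂ _⊞_ (⊛-additiveʳ x x y) (⊛-additiveʳ y x y) ⟩
    x ⊛ x ⊞ x ⊛ y ⊞ (y ⊛ x ⊞ y ⊛ y)      ≡⟨ cong (λ z → x ⊛ x ⊞ x ⊛ y ⊞ (z ⊞ y ⊛ y)) (⊛-comm y x) ⟩
    x ⊛ x ⊞ x ⊛ y ⊞ (x ⊛ y ⊞ y ⊛ y)      ≡⟨ ⊞-solve (x ⊛ x ∷ x ⊛ y ∷ y ⊛ y ∷ [])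
                                              (x₀ :+ x₁ :+ (x₁ :+ x₂)) (x₀ :+ x₂) refl ⟩
    x ⊛ x ⊞ y ⊛ y                        ∎
    where open ≡-Reasoning

  frob-⊞ : ∀ N → Additive (frob N)
  frob-⊞ = iter-additive square-⊞

  frob-⊛ : ∀ N x y → frob N (x ⊛ y) ≡ frob N x ⊛ frob N y
  frob-⊛ zero x y = refl
  frob-⊛ (suc N) x y = trans (cong square (frob-⊛ N x y)) (⊛-interchange (frob N x) (frob N y) (frob N x) (frob N y))

  frob-1 : ∀ N → frob N 1ₖ ≡ 1ₖ
  frob-1 zero = refl
  frob-1 (suc N) = trans (cong square (frob-1 N)) (⊛-identityˡ 1ₖ)

  frob-ker : ∀ N x → frob N x ≡ 0ᵥ → x ≡ 0ᵥ
  frob-ker zero x eq = eq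
  frob-ker (suc N) x eq = frob-ker N x (square-ker (frob N x) eq)
    where
    square-ker : ∀ x → square x ≡ 0ᵥ → x ≡ 0ᵥ
    square-ker x eq with x ≟ᵥ 0ᵥ
    ... | yes x≡0 = x≡0
    ... | no x≢0 = op-ker S-⊞ f-S x x≢0 x eq

  frob-injective : ∀ N {x y} → frob N x ≡ frob N y → x ≡ y
  frob-injective N = additive-injective (frob-⊞ N) (frob-ker N)

  frob-eval : ∀ N p x → All (λ a → frob N a ≡ a) p → eval p (frob N x) ≡ frob N (eval p x)
  frob-eval N [] x [] = sym (additive-0 (frob-⊞ N))
  frob-eval N (a ∷ p) x (fixed ∷ fixeds) = sym (begin
    frob N (a ⊞ x ⊛ eval p x)               ≡⟨ frob-⊞ N a (x ⊛ eval p x) ⟩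
    frob N a ⊞ frob N (x ⊛ eval p x)        ≡⟨ cong₂ _⊞_ fixed (frob-⊛ N x (eval p x)) ⟩
    a ⊞ frob N x ⊛ frob N (eval p x)        ≡⟨ cong (λ z → a ⊞ frob N x ⊛ z) (frob-eval N p x fixeds) ⟨
    a ⊞ frob N x ⊛ eval p (frob N x)        ∎)
    where open ≡-Reasoning

  -- The conjugates of a root are roots, so fewer of them than coefficients are distinct.
  conjugates : ∀ N p x → All (λ a → frob N a ≡ a) p → eval p x ≡ 0ᵥ →
               (∃ λ i → 1 ≤ i × i < length p × frob (i * N) x ≡ x) ⊎ Zero p
  conjugates N p x fixed root
    with ℕ.anyUpTo? (λ i → (1 ℕ.≤? i) ×-dec (frob (i * N) x ≟ᵥ x)) (length p)
  ... | yes (i , i<l , 1≤i , eq) = inj₁ (i , 1≤i , i<l , eq)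
  ... | no none = inj₂ (root-bound p (applyUpTo (λ i → frob (i * N) x) (length p))
    (Unique.applyUpTo⁺₁ _ (length p) distinct)
    (All.applyUpTo⁺₂ _ (length p) conjugate)
    (≤-reflexive (sym (length-applyUpTo _ (length p)))))
    where
    conjugate : ∀ i → eval p (frob (i * N) x) ≡ 0ᵥ
    conjugate zero = root
    conjugate (suc i) = begin
      eval p (frob (N + i * N) x)       ≡⟨ cong (eval p) (iter-+ square N (i * N) x) ⟩
      eval p (frob N (frob (i * N) x))  ≡⟨ frob-eval N p (frob (i * N) x) fixed ⟩
      frob N (eval p (frob (i * N) x))  ≡⟨ cong (frob N) (conjugate i) ⟩
      frob N 0ᵥ                         ≡⟨ additive-0 (frob-⊞ N) ⟩
      0ᵥ                                ∎
      where open ≡-Reasoning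
    distinct : ∀ {i j} → i < j → j < length p → frob (i * N) x ≢ frob (j * N) x
    distinct {i} {j} i<j j<l eq = none (j ∸ i , ℕ.≤-<-trans (ℕ.m∸n≤m j i) j<l , ℕ.m<n⇒0<n∸m i<j ,
      sym (frob-injective (i * N) (trans eq (begin
        frob (j * N) x                        ≡⟨ cong (λ k → frob (k * N) x) (ℕ.m+[n∸m]≡n (ℕ.<⇒≤ i<j)) ⟨
        frob ((i + (j ∸ i)) * N) x            ≡⟨ cong (λ k → frob k x) (ℕ.*-distribʳ-+ N i (j ∸ i)) ⟩
        frob (i * N + (j ∸ i) * N) x          ≡⟨ iter-+ square (i * N) ((j ∸ i) * N) x ⟩
        frob (i * N) (frob ((j ∸ i) * N) x)   ∎))))
      where open ≡-Reasoning

  θ^ : ℕ → K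
  θ^ k = iter S k 1ₖ

  frob-θ : ∀ N → frob N θ ≡ θ^ (2 ^ N)
  frob-θ zero = refl
  frob-θ (suc N) = begin
    square (frob N θ)                   ≡⟨ cong square (frob-θ N) ⟩
    θ^ (2 ^ N) ⊛ θ^ (2 ^ N)             ≡⟨ iter-S-⊛ (2 ^ N) 1ₖ (θ^ (2 ^ N)) ⟩
    iter S (2 ^ N) (1ₖ ⊛ θ^ (2 ^ N))    ≡⟨ cong (iter S (2 ^ N)) (⊛-identityˡ (θ^ (2 ^ N))) ⟩
    iter S (2 ^ N) (θ^ (2 ^ N))         ≡⟨ iter-+ S (2 ^ N) (2 ^ N) 1ₖ ⟨
    θ^ (2 ^ N + 2 ^ N)                  ≡⟨ cong (λ k → θ^ (2 ^ N + k)) (+-identityʳ (2 ^ N)) ⟨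
    θ^ (2 ^ suc N)                      ∎
    where open ≡-Reasoning

  -- The powers of θ exhaust the 2 ^ d − 1 nonzero elements.
  frob-θ-order : ∀ N → 1 ≤ N → frob N θ ≡ θ → d ≤ N
  frob-θ-order N 1≤N eq with 2 ^ N in 2^N≡ | ℕ.^-monoʳ-≤ 2 {x = 1} {y = N} 1≤N
  ... | suc (suc M) | s≤s (s≤s z≤n) = ℕ.≮⇒≥ λ N<d →
    ℕ.<⇒≱ (ℕ.^-monoʳ-< 2 ≤-refl N<d) (subst (2 ^ d ≤_) (sym 2^N≡) counting)
    where
    -- Cancelling one factor θ in θ^(2^N) = θ leaves the exponent 2^N - 1, which is `suc M`.
    cycle : θ^ (suc M) ≡ 1ₖ
    cycle = additive-injective S-⊞ (operator-ker S-⊞ f-S)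
      (trans (cong θ^ (sym 2^N≡)) (trans (sym (frob-θ N)) eq))
    powers : List K
    powers = applyUpTo θ^ (suc M)
    power-∈ : ∀ k → θ^ k ∈ powers
    power-∈ zero = here refl
    power-∈ (suc k) with ∈-applyUpTo⁻ θ^ {n = suc M} (power-∈ k)
    ... | j , j≤M , eq with suc j ℕ.<? suc M
    ...   | yes j<M = subst (_∈ powers) (cong S (sym eq)) (∈-applyUpTo⁺ θ^ j<M)
    ...   | no j≮M = subst (_∈ powers)
      (trans (sym cycle) (trans (cong θ^ (ℕ.≤-antisym (ℕ.≮⇒≥ j≮M) j≤M)) (cong S (sym eq)))) (here refl)
    complete : ∀ u → u ∈ 0ᵥ ∷ powers
    complete u with u ≟ᵥ 0ᵥ
    ... | yes u≡0 = here u≡0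
    ... | no u≢0 with power u u≢0
    ...   | k , pow = there (subst (_∈ powers) (trans (sym (pow S-⊞ f-S 1ₖ)) (reduce-toList u)) (power-∈ k))
    counting : 2 ^ d ≤ suc (suc M)
    counting = subst (2 ^ d ≤_) (cong suc (length-applyUpTo θ^ (suc M))) (exhausting⇒length≥ (0ᵥ ∷ powers) complete)

-- TSR matrices

lookup-ext : ∀ {A : Set} {n} {xs ys : Vec A n} → (∀ i → lookup xs i ≡ lookup ys i) → xs ≡ ys
lookup-ext {xs = xs} {ys} eq = trans (sym (tabulate∘lookup xs)) (trans (tabulate-cong eq) (tabulate∘lookup ys))

lookup-unit : ∀ {k} (i j : Fin k) → lookup (unit i) j ≡ δ i j
lookup-unit i j = trans (cong (λ u → lookup u j) (sym (tabulate-δ i))) (lookup∘tabulate (δ i) j)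

lookup-· : ∀ {k} a (v : V k) i → lookup (a · v) i ≡ a ∧ lookup v i
lookup-· true v i = refl
lookup-· false v i = lookup-replicate i false

lookup-orbit : ∀ {k} (T : V k → V k) v {n} (i : Fin n) → lookup (orbit T v n) i ≡ iter T (toℕ i) v
lookup-orbit T v zero = refl
lookup-orbit T v (suc i) = trans (lookup-orbit T (T v) i) (iter-shift T (toℕ i) v)

comb-δ : ∀ {n k} (c : V n) (a : Fin n) (v : V k) → comb c (tabulate λ i → δ a i · v) ≡ lookup c a · v
comb-δ {suc n} (b ∷ c) zero v =
  trans (cong (b · v ⊞_) (vanish c)) (⊞-identityʳ _)
  where
  vanish : ∀ {n} (c : V n) → comb c (tabulate λ _ → 0ᵥ) ≡ 0ᵥ
  vanish [] = refl
  vanish (b ∷ c) = trans (cong₂ _⊞_ (·-zeroʳ b) (vanish c)) (⊞-self 0ᵥ)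
comb-δ (b ∷ c) (suc a) v = trans (cong₂ _⊞_ (·-zeroʳ b) (comb-δ c a v)) (⊞-identityˡ _)

module Blocks (n m : ℕ) where

  block : Fin n → V (n * m) → V m
  block i v = tabulate λ r → lookup v (combine i r)

  glue : (Fin n → V m) → V (n * m)
  glue g = tabulate λ x → lookup (g (proj₁ (remQuot {n} m x))) (proj₂ (remQuot {n} m x))

  lookup-block : ∀ i v r → lookup (block i v) r ≡ lookup v (combine i r)
  lookup-block i v r = lookup∘tabulate _ r

  block-glue : ∀ g i → block i (glue g) ≡ g i
  block-glue g i = lookup-ext λ r → trans (lookup-block i (glue g) r)
    (trans (lookup∘tabulate _ (combine i r))
      (cong (λ x → lookup (g (proj₁ x)) (proj₂ x)) (remQuot-combine {n} i r)))

  block-ext : ∀ {u v} → (∀ i → block i u ≡ block i v) → u ≡ v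
  block-ext {u} {v} eq = lookup-ext λ x → subst (λ y → lookup u y ≡ lookup v y) (combine-remQuot {n} m x)
    (let i , r = remQuot {n} m x in
     trans (sym (lookup-block i u r)) (trans (cong (λ w → lookup w r) (eq i)) (lookup-block i v r)))

  block-⊞ : ∀ i → Additive (block i)
  block-⊞ i u v = lookup-ext λ r → trans (lookup-block i (u ⊞ v) r)
    (trans (lookup-zipWith _xor_ (combine i r) u v)
      (sym (trans (lookup-zipWith _xor_ r (block i u) (block i v))
        (cong₂ _xor_ (lookup-block i u r) (lookup-block i v r)))))

  block-unit : ∀ a b i → block i (unit (combine a b)) ≡ δ a i · unit b
  block-unit a b i = lookup-ext λ r → trans (lookup-block i (unit (combine a b)) r)
    (trans (lookup-unit (combine a b) (combine i r))
      (trans (split r) (sym (trans (lookup-· (δ a i) (unit b) r) (cong (δ a i ∧_) (lookup-unit b r))))))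
    where
    split : ∀ r → δ (combine a b) (combine i r) ≡ δ a i ∧ δ b r
    split r with a ≟ᶠ i | b ≟ᶠ r
    ... | yes refl | yes refl = dec-true (combine a b ≟ᶠ combine a b) refl
    ... | yes refl | no b≢r =
      dec-false (combine a b ≟ᶠ combine a r) (b≢r ∘ proj₂ ∘ combine-injective a b a r)
    ... | no a≢i | _ =
      dec-false (combine a b ≟ᶠ combine i r) (a≢i ∘ proj₁ ∘ combine-injective a b i r)

  -- Repeats the local function in the definition of `tsr`, with which it agrees by computation.
  entry : V n → Mat Bool m → Fin n × Fin m → Fin n × Fin m → Bool
  entry c A (a , b) (j , r) =
    if does (suc (toℕ j) ℕ.≟ n) then lookup c a ∧ lookup (lookup A b) r
    else (if does (toℕ a ℕ.≟ suc (toℕ j)) then δ b r else false)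

  lookup-tsr : ∀ c A a b j r →
    lookup (lookup (tsr m n c A) (combine a b)) (combine j r) ≡ entry c A (a , b) (j , r)
  lookup-tsr c A a b j r =
    trans (cong (λ row → lookup row (combine j r)) (lookup∘tabulate _ (combine a b)))
      (trans (lookup∘tabulate _ (combine j r))
        (cong₂ (entry c A) (remQuot-combine {n} {m} a b) (remQuot-combine {n} {m} j r)))

  T⟨_,_⟩ : V n → Mat Bool m → V (n * m) → V (n * m)
  T⟨ c , A ⟩ = rowAct (tsr m n c A)

  T-⊞ : ∀ c A → Additive T⟨ c , A ⟩
  T-⊞ c A = comb-additive (tsr m n c A)

  blocks : V (n * m) → Vec (V m) n
  blocks v = tabulate (λ i → block i v)

  lookup-blocks : ∀ v i → lookup (blocks v) i ≡ block i v
  lookup-blocks v = lookup∘tabulate λ i → block i v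

  block-≗ : ∀ {k} {φ ψ : V (n * m) → V k} → Additive φ → Additive ψ →
            (∀ a b → φ (unit (combine a b)) ≡ ψ (unit (combine {n} {m} a b))) → ∀ v → φ v ≡ ψ v
  block-≗ {φ = φ} {ψ} φ-⊞ ψ-⊞ eq = additive-≗ φ-⊞ ψ-⊞ λ x →
    subst (λ y → φ (unit y) ≡ ψ (unit y)) (combine-remQuot {n} m x) (eq _ _)

  module _ (c : V n) (A : Mat Bool m) where

    private T = T⟨ c , A ⟩

    block-T-unit : ∀ (j a : Fin n) (b r : Fin m) → lookup (block j (T (unit (combine a b)))) r ≡
                   lookup (lookup (tsr m n c A) (combine a b)) (combine j r)
    block-T-unit j a b r = trans (lookup-block j (T (unit (combine a b))) r)
      (cong (λ w → lookup w (combine j r)) (comb-unit (combine a b) (tsr m n c A)))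

    -- On row vectors T is the step of a shift register: a block column other than the last has I in
    -- the row of the next block and zeros elsewhere.
    block-shift : ∀ i j → toℕ i ≡ suc (toℕ j) → ∀ v → block j (T v) ≡ block i v
    block-shift i j i≡1+j = block-≗
      (λ u v → trans (cong (block j) (T-⊞ c A u v)) (block-⊞ j (T u) (T v))) (block-⊞ i)
      λ a b → lookup-ext λ r → trans (block-T-unit j a b r) (trans (lookup-tsr c A a b j r)
        (trans (not-last a b r)
          (sym (trans (cong (λ w → lookup w r) (block-unit a b i)) (trans (lookup-· (δ a i) (unit b) r)
            (cong (δ a i ∧_) (lookup-unit b r)))))))
      where
      not-last : ∀ a b r →
        entry c A (a , b) (j , r) ≡ δ a i ∧ δ b r
      not-last a b r
        rewrite dec-false (suc (toℕ j) ℕ.≟ n) (λ eq → ℕ.<⇒≢ (toℕ<n i) (trans i≡1+j eq))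
        with a ≟ᶠ i
      ... | yes refl rewrite dec-true (toℕ a ℕ.≟ suc (toℕ j)) i≡1+j = refl
      ... | no a≢i rewrite dec-false (toℕ a ℕ.≟ suc (toℕ j)) (λ eq → a≢i (toℕ-injective (trans eq (sym i≡1+j)))) = refl

    comb-blocks-⊞ : Additive (comb c ∘ blocks)
    comb-blocks-⊞ u v = trans (cong (comb c) (tabulate-cong λ i → block-⊞ i u v)) (sum c _ _)
      where
      sum : ∀ {n} (c : V n) (g h : Fin n → V m) →
            comb c (tabulate λ i → g i ⊞ h i) ≡ comb c (tabulate g) ⊞ comb c (tabulate h)
      sum [] g h = sym (⊞-self 0ᵥ)
      sum (a ∷ c) g h = trans (cong₂ _⊞_ (·-distribˡ a (g zero) (h zero)) (sum c (g ∘ suc) (h ∘ suc)))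
        (medial _ _ _ _)

    -- The last block column consists of the blocks c_a A, so the register is fed with Σ c_a v_a
    -- times A.
    block-last : ∀ j → suc (toℕ j) ≡ n → ∀ v → block j (T v) ≡ comb (comb c (blocks v)) A
    block-last j last = block-≗
      (λ u v → trans (cong (block j) (T-⊞ c A u v)) (block-⊞ j (T u) (T v)))
      (λ u v → trans (cong (λ w → comb w A) (comb-blocks-⊞ u v)) (comb-⊞ (comb c (blocks u)) (comb c (blocks v)) A))
      λ a b → trans (lookup-ext λ r → trans (block-T-unit j a b r) (trans (lookup-tsr c A a b j r) (is-last a b r)))
        (sym (trans (cong (λ w → comb w A) (trans (cong (comb c) (tabulate-cong (block-unit a b))) (comb-δ c a (unit b))))
          (trans (additive-· (comb-additive A) (lookup c a) (unit b)) (cong (lookup c a ·_) (comb-unit b A)))))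
      where
      is-last : ∀ a b r →
        entry c A (a , b) (j , r) ≡ lookup (lookup c a · lookup A b) r
      is-last a b r rewrite dec-true (suc (toℕ j) ℕ.≟ n) last = sym (lookup-· (lookup c a) (lookup A b) r)

    block-iter : ∀ k i j → toℕ i ≡ toℕ j + k → ∀ v → block j (iter T k v) ≡ block i v
    block-iter zero i j eq v = cong (λ i → block i v) (sym (toℕ-injective (trans eq (+-identityʳ _))))
    block-iter (suc k) i j eq v = trans (block-shift j′ j (toℕ-fromℕ< j′<n) (iter T k v))
      (block-iter k i j′ (trans eq (trans (+-suc (toℕ j) k) (cong (_+ k) (sym (toℕ-fromℕ< j′<n))))) v)
      where
      j′<n : suc (toℕ j) < n
      j′<n = ℕ.≤-<-trans (ℕ.≤-trans (ℕ.m≤m+n (suc (toℕ j)) k) (ℕ.≤-reflexive (trans (sym (+-suc (toℕ j) k)) (sym eq)))) (toℕ<n i)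
      j′ : Fin n
      j′ = fromℕ< j′<n

  -- Similarity of TSR matrices with the same `c`

  blockwise : (V m → V m) → V (n * m) → V (n * m)
  blockwise φ v = glue λ i → φ (block i v)

  block-blockwise : ∀ φ v i → block i (blockwise φ v) ≡ φ (block i v)
  block-blockwise φ v = block-glue λ i → φ (block i v)

  blockwise-⊞ : ∀ {φ} → Additive φ → Additive (blockwise φ)
  blockwise-⊞ {φ} φ-⊞ u v = block-ext λ i → begin
    block i (blockwise φ (u ⊞ v))                        ≡⟨ block-blockwise φ (u ⊞ v) i ⟩
    φ (block i (u ⊞ v))                                  ≡⟨ cong φ (block-⊞ i u v) ⟩
    φ (block i u ⊞ block i v)                            ≡⟨ φ-⊞ (block i u) (block i v) ⟩
    φ (block i u) ⊞ φ (block i v)                        ≡⟨ cong₂ _⊞_ (block-blockwise φ u i) (block-blockwise φ v i) ⟨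
    block i (blockwise φ u) ⊞ block i (blockwise φ v)    ≡⟨ block-⊞ i (blockwise φ u) (blockwise φ v) ⟨
    block i (blockwise φ u ⊞ blockwise φ v)              ∎
    where open ≡-Reasoning

  -- `blockwise φ` is I ⊗ φ. The c_i lie in F₂, so an additive `φ` passes through the feedback sum
  -- and then trades `A` for `A′`.
  blockwise-intertwines : ∀ {φ A A′} → Additive φ → (∀ v → φ (comb v A) ≡ comb (φ v) A′) → ∀ c v →
                          blockwise φ (T⟨ c , A ⟩ v) ≡ T⟨ c , A′ ⟩ (blockwise φ v)
  blockwise-intertwines {φ} {A} {A′} φ-⊞ comm c v = block-ext λ j → trans (block-blockwise φ (T⟨ c , A ⟩ v) j) (blockCase j)
    where
    blockCase : ∀ j → φ (block j (T⟨ c , A ⟩ v)) ≡ block j (T⟨ c , A′ ⟩ (blockwise φ v))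
    blockCase j with suc (toℕ j) ℕ.<? n
    ... | yes j′<n = begin
      φ (block j (T⟨ c , A ⟩ v))             ≡⟨ cong φ (block-shift c A (fromℕ< j′<n) j (toℕ-fromℕ< j′<n) v) ⟩
      φ (block (fromℕ< j′<n) v)              ≡⟨ block-blockwise φ v (fromℕ< j′<n) ⟨
      block (fromℕ< j′<n) (blockwise φ v)    ≡⟨ block-shift c A′ (fromℕ< j′<n) j (toℕ-fromℕ< j′<n) (blockwise φ v) ⟨
      block j (T⟨ c , A′ ⟩ (blockwise φ v))  ∎
      where open ≡-Reasoning
    ... | no j′≮n = begin
      φ (block j (T⟨ c , A ⟩ v))                  ≡⟨ cong φ (block-last c A j last v) ⟩
      φ (comb (comb c (blocks v)) A)              ≡⟨ comm (comb c (blocks v)) ⟩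
      comb (φ (comb c (blocks v))) A′             ≡⟨ cong (λ w → comb w A′) (trans (additive-comb φ-⊞ c (blocks v))
                                                       (cong (comb c) blocks-φ)) ⟩
      comb (comb c (blocks (blockwise φ v))) A′   ≡⟨ block-last c A′ j last (blockwise φ v) ⟨
      block j (T⟨ c , A′ ⟩ (blockwise φ v))       ∎
      where
      open ≡-Reasoning
      last : suc (toℕ j) ≡ n
      last = ℕ.≤-antisym (toℕ<n j) (ℕ.≮⇒≥ j′≮n)
      blocks-φ : Vec.map φ (blocks v) ≡ blocks (blockwise φ v)
      blocks-φ = lookup-ext λ i → trans (lookup-map i φ (blocks v))
        (trans (cong φ (lookup-blocks v i))
          (trans (sym (block-blockwise φ v i)) (sym (lookup-blocks (blockwise φ v) i))))

  module _ {φ : V m → V m} {A A′ : Mat Bool m} (φ-⊞ : Additive φ)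
           (comm : ∀ v → φ (comb v A) ≡ comb (φ v) A′) (c : V n) (f : Poly) where

    private
      intertwine : ∀ v → blockwise φ (act T⟨ c , A ⟩ f v) ≡ act T⟨ c , A′ ⟩ f (blockwise φ v)
      intertwine = act-intertwine (blockwise-⊞ φ-⊞) (blockwise-intertwines φ-⊞ comm c) f

    annihilates-image : (∀ v → ∃ λ u → φ u ≡ v) → (∀ v → act T⟨ c , A ⟩ f v ≡ 0ᵥ) →
                        ∀ v → act T⟨ c , A′ ⟩ f v ≡ 0ᵥ
    annihilates-image surj f-T v = begin
      act T⟨ c , A′ ⟩ f v                    ≡⟨ cong (act T⟨ c , A′ ⟩ f) v≡Φu ⟩
      act T⟨ c , A′ ⟩ f (blockwise φ u)      ≡⟨ intertwine u ⟨
      blockwise φ (act T⟨ c , A ⟩ f u)       ≡⟨ cong (blockwise φ) (f-T u) ⟩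
      blockwise φ 0ᵥ                         ≡⟨ additive-0 (blockwise-⊞ φ-⊞) ⟩
      0ᵥ                                     ∎
      where
      open ≡-Reasoning
      g : Fin n → V m
      g i = proj₁ (surj (block i v))
      u = glue g
      v≡Φu : v ≡ blockwise φ u
      v≡Φu = block-ext λ i → sym (trans (block-blockwise φ u i)
        (trans (cong φ (block-glue g i)) (proj₂ (surj (block i v)))))

    annihilates-preimage : (∀ v → φ v ≡ 0ᵥ → v ≡ 0ᵥ) → (∀ v → act T⟨ c , A′ ⟩ f v ≡ 0ᵥ) →
                           ∀ v → act T⟨ c , A ⟩ f v ≡ 0ᵥ
    annihilates-preimage ker f-T v = block-ext λ i →
      trans (ker (block i w) (trans (sym (block-blockwise φ w i)) (trans (cong (block i) (trans (intertwine v) (f-T _)))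
        (additive-0 (block-⊞ i))))) (sym (additive-0 (block-⊞ i)))
      where
      w = act T⟨ c , A ⟩ f v

-- s is the first block; the sequence s(Tⁱ v) is the σ-LFSR sequence with initial blocks v.
module FirstBlock (n′ m : ℕ) where

  private n = suc n′
  open Blocks n m public

  s : V (n * m) → V m
  s = block zero

  s-⊞ : Additive s
  s-⊞ = block-⊞ zero

  -- Where c_i = 1, block i of the last column is the matrix itself.
  tsr-injective : ∀ c {i} → lookup c i ≡ true → ∀ {A A′} → tsr m n c A ≡ tsr m n c A′ → A ≡ A′
  tsr-injective c {i} cᵢ {A} {A′} eq = lookup-ext λ b → lookup-ext λ r →
    trans (sym (recover A b r)) (trans (cong (λ T → lookup (lookup T (combine i b)) (combine last r)) eq) (recover A′ b r))
    where
    last = fromℕ n′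
    recover : ∀ A b r → lookup (lookup (tsr m n c A) (combine i b)) (combine last r) ≡ lookup (lookup A b) r
    recover A b r = trans (lookup-tsr c A i b last r) (lemma (dec-true (suc (toℕ last) ℕ.≟ n) (cong suc (toℕ-fromℕ n′))))
      where
      lemma : ∀ {d y} → d ≡ true → (if d then lookup c i ∧ lookup (lookup A b) r else y) ≡ lookup (lookup A b) r
      lemma refl = cong (_∧ lookup (lookup A b) r) cᵢ

  module _ (c : V n) (A : Mat Bool m) where

    private T = T⟨ c , A ⟩

    block-s : ∀ i v → block i v ≡ s (iter T (toℕ i) v)
    block-s i v = sym (block-iter c A (toℕ i) i zero refl v)

    s-faithful : ∀ v → (∀ i → s (iter T i v) ≡ 0ᵥ) → v ≡ 0ᵥ
    s-faithful v eq = block-ext λ i → trans (block-s i v) (trans (eq (toℕ i)) (sym (additive-0 (block-⊞ i))))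

    s-recurrence : ∀ v → s (iter T n v) ≡ comb (s (act T (toList c) v)) A
    s-recurrence v = begin
      s (T (iter T n′ v))                     ≡⟨ cong s (iter-shift T n′ v) ⟨
      -- After one step the new block stands last; `n′` further steps carry it to the front.
      s (iter T n′ (T v))                     ≡⟨ block-iter c A n′ (fromℕ n′) zero (toℕ-fromℕ n′) (T v) ⟩
      block (fromℕ n′) (T v)                  ≡⟨ block-last c A (fromℕ n′) (cong suc (toℕ-fromℕ n′)) v ⟩
      comb (comb c (blocks v)) A              ≡⟨ cong (λ bs → comb (comb c bs) A) blocks-orbit ⟩
      comb (comb c (Vec.map s (orbit T v n))) A ≡⟨ cong (λ w → comb w A) (additive-comb s-⊞ c (orbit T v n)) ⟨
      comb (s (comb c (orbit T v n))) A       ≡⟨ cong (λ w → comb (s w) A) (comb-orbit (T-⊞ c A) c v) ⟩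
      comb (s (act T (toList c) v)) A         ∎
      where
      open ≡-Reasoning
      blocks-orbit : blocks v ≡ Vec.map s (orbit T v n)
      blocks-orbit = lookup-ext λ i → trans (lookup-blocks v i) (trans (block-s i v)
        (sym (trans (lookup-map i s (orbit T v n)) (cong s (lookup-orbit T v i)))))

    -- With c = 0 the register takes in only zero blocks. Since f(T) = 0 makes T injective, this
    -- will exclude c = 0.
    zero⇒nilpotent : c ≡ 0ᵥ → ∀ v → iter T n v ≡ 0ᵥ
    zero⇒nilpotent refl v = s-faithful (iter T n v) λ i → begin
      s (iter T i (iter T n v))                  ≡⟨ cong s (trans (sym (iter-+ T i n v))
                                                      (trans (cong (λ k → iter T k v) (ℕ.+-comm i n)) (iter-+ T n i v))) ⟩
      s (iter T n (iter T i v))                  ≡⟨ s-recurrence (iter T i v) ⟩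
      comb (s (act T (toList c) (iter T i v))) A ≡⟨ cong (λ w → comb (s w) A)
                                                      (trans (sym (comb-orbit (T-⊞ c A) (0ᵥ {n}) _)) (comb-0 (orbit T (iter T i v) n))) ⟩
      comb (s 0ᵥ) A                              ≡⟨ cong (λ w → comb w A) (additive-0 s-⊞) ⟩
      comb 0ᵥ A                                  ≡⟨ comb-0 A ⟩
      0ᵥ                                         ∎
      where open ≡-Reasoning

-- The parameters of a TSR matrix are determined by its characteristic polynomial

nonzero-entry : ∀ {k} (c : V k) → c ≢ 0ᵥ → ∃ λ i → lookup c i ≡ true
nonzero-entry [] c≢0 = contradiction refl c≢0
nonzero-entry (true ∷ c) c≢0 = zero , refl
nonzero-entry (false ∷ c) c≢0 with nonzero-entry c (c≢0 ∘ cong (false ∷_))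
... | i , cᵢ = suc i , cᵢ

·-cancelʳ : ∀ {k} a b {v : V k} → v ≢ 0ᵥ → a · v ≡ b · v → a ≡ b
·-cancelʳ true true v≢0 eq = refl
·-cancelʳ true false v≢0 eq = contradiction eq v≢0
·-cancelʳ false true v≢0 eq = contradiction (sym eq) v≢0
·-cancelʳ false false v≢0 eq = refl

pad-toList-0 : ∀ {k} d (c : V k) → k ≤ d → pad d (toList c) ≡ 0ᵥ → c ≡ 0ᵥ
pad-toList-0 d [] le eq = refl
pad-toList-0 (suc d) (a ∷ c) (s≤s le) eq = cong₂ _∷_ (cong Vec.head eq) (pad-toList-0 d c le (cong Vec.tail eq))

module Situation (n′ m″ : ℕ) where

  -- In this form `n * m` computes to a double successor, as `Field` requires.
  n m : ℕ
  n = suc n′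
  m = suc (suc m″)

  open FirstBlock n′ m

  module Fixed (fv : V (n * m)) (gen : RootGenerates (toList fv ∷ʳ true)) where

    open Field fv gen

    -- The polynomial a p over K: `embed γ` yields γ g, and `embed 1ₖ` is the inclusion of F₂[X].
    embed : K → Poly → List K
    embed a = List.map (_· a)

    eval-embed : ∀ a p x → eval (embed a p) x ≡ a ⊛ p at x
    eval-embed a [] x = sym (⊛-zeroʳ a)
    eval-embed a (b ∷ p) x = begin
      b · a ⊞ x ⊛ eval (embed a p) x        ≡⟨ cong₂ (λ y z → y ⊞ x ⊛ z)
                                                 (trans (cong (b ·_) (sym (⊛-identityʳ a)))
                                                   (sym (additive-· (⊛-additiveʳ a) b 1ₖ)))
                                                 (eval-embed a p x) ⟩
      a ⊛ (b · 1ₖ) ⊞ x ⊛ (a ⊛ p at x)       ≡⟨ cong (a ⊛ (b · 1ₖ) ⊞_) (begin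
        x ⊛ (a ⊛ p at x)                      ≡⟨ ⊛-assoc x a (p at x) ⟨
        (x ⊛ a) ⊛ p at x                      ≡⟨ cong (_⊛ p at x) (⊛-comm x a) ⟩
        (a ⊛ x) ⊛ p at x                      ≡⟨ ⊛-assoc a x (p at x) ⟩
        a ⊛ (x ⊛ p at x)                      ∎) ⟩
      a ⊛ (b · 1ₖ) ⊞ a ⊛ (x ⊛ p at x)       ≡⟨ ⊛-additiveʳ a (b · 1ₖ) (x ⊛ p at x) ⟨
      a ⊛ (b · 1ₖ ⊞ x ⊛ p at x)             ∎
      where open ≡-Reasoning

    at-θ : ∀ p → p at θ ≡ reduce p
    at-θ p = act-cong θ-⊛ p 1ₖ

    eval-θ-∷ʳ : ∀ p a → eval (p ∷ʳ a) θ ≡ eval p θ ⊞ iter S (length p) a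
    eval-θ-∷ʳ [] a = trans (cong (a ⊞_) (⊛-zeroʳ θ)) (⊞-comm a 0ᵥ)
    eval-θ-∷ʳ (b ∷ p) a = begin
      b ⊞ θ ⊛ eval (p ∷ʳ a) θ                    ≡⟨ cong (λ z → b ⊞ θ ⊛ z) (eval-θ-∷ʳ p a) ⟩
      b ⊞ θ ⊛ (eval p θ ⊞ iter S (length p) a)   ≡⟨ cong (b ⊞_) (⊛-additiveʳ θ (eval p θ) (iter S (length p) a)) ⟩
      b ⊞ (θ ⊛ eval p θ ⊞ θ ⊛ iter S (length p) a) ≡⟨ ⊞-assoc b (θ ⊛ eval p θ) (θ ⊛ iter S (length p) a) ⟨
      b ⊞ θ ⊛ eval p θ ⊞ θ ⊛ iter S (length p) a ≡⟨ cong (b ⊞ θ ⊛ eval p θ ⊞_) (θ-⊛ (iter S (length p) a)) ⟩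
      b ⊞ θ ⊛ eval p θ ⊞ S (iter S (length p) a) ∎
      where open ≡-Reasoning

    fixed-embed : ∀ N a → frob N a ≡ a → ∀ p → All (λ x → frob N x ≡ x) (embed a p)
    fixed-embed N a fixed [] = []
    fixed-embed N a fixed (b ∷ p) = trans (additive-· (frob-⊞ N) b a) (cong (b ·_) fixed) ∷ fixed-embed N a fixed p

    zero-embed : ∀ {k} (u : V k) → Zero (embed 1ₖ (toList u)) → u ≡ 0ᵥ
    zero-embed [] [] = refl
    zero-embed (a ∷ u) (eq ∷ zs) = cong₂ _∷_ (·-cancelʳ a false {1ₖ} (λ ()) eq) (zero-embed u zs)

    -- Two monic annihilators of degree mn differ by a polynomial of lower degree, that is, by an
    -- element of K. It kills a nonzero vector, hence is zero.
    charPoly-unique : ∀ (M : Mat Bool (n * m)) → (∀ v → act (rowAct M) f v ≡ 0ᵥ) → charPoly M ≡ f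
    charPoly-unique M f-M with charPoly-monic M
    ... | u , χ≡ = trans χ≡ (cong (λ w → toList w ∷ʳ true) (⊞≡0⇒≡ u fv
      (op-faithful M-⊞ f-M (u ⊞ fv) (true ∷ 0ᵥ) (λ ()) (begin
        act M′ (toList (u ⊞ fv)) v                      ≡⟨ act-toList-⊞ M-⊞ u fv v ⟩
        act M′ (toList u) v ⊞ act M′ (toList fv) v      ≡⟨ cong₂ _⊞_ (top-power u (trans (cong (λ p → act M′ p v) (sym χ≡)) (cayley-hamilton M v)))
                                                             (top-power fv (f-M v)) ⟩
        iter M′ (n * m) v ⊞ iter M′ (n * m) v           ≡⟨ ⊞-self (iter M′ (n * m) v) ⟩
        0ᵥ                                              ∎))))
      where
      open ≡-Reasoning
      M′ = rowAct M
      M-⊞ = comb-additive M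
      v = true ∷ 0ᵥ
      top-power : ∀ (w : V (n * m)) → act M′ (toList w ∷ʳ true) v ≡ 0ᵥ → act M′ (toList w) v ≡ iter M′ (n * m) v
      top-power w eq = trans (⊞≡0⇒≡ _ _ (trans (sym (act-∷ʳ M-⊞ (toList w) true v)) eq))
        (cong (λ k → iter M′ k v) (length-toList w))

    -- The space becomes a K-vector space of dimension one on which T acts as θ, and
    -- γ = θⁿ / g(θ) acts on the first block as A.
    module ForT (c : V n) (A : Mat Bool m) (f-T : ∀ v → act T⟨ c , A ⟩ f v ≡ 0ᵥ) where

      private
        T = T⟨ c , A ⟩
        open Module (T-⊞ c A) f-T

      θ^n≢0 : θ^ n ≢ 0ᵥ
      θ^n≢0 eq with iter-ker S-⊞ f-S n 1ₖ eq
      ... | ()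

      c≢0 : c ≢ 0ᵥ
      c≢0 c≡0 with iter-ker (T-⊞ c A) f-T n (true ∷ 0ᵥ) (zero⇒nilpotent c A c≡0 (true ∷ 0ᵥ))
      ... | ()

      g : K
      g = reduce (toList c)

      -- `c` has n ≤ mn coefficients, so no reduction modulo f takes place and g = 0 would mean c =
      -- 0.
      g≢0 : g ≢ 0ᵥ
      g≢0 eq = c≢0 (pad-toList-0 (n * m) c n≤d
        (trans (sym (reduce-pad (toList c) (≤-trans (≤-reflexive (length-toList c)) n≤d))) eq))
        where
        n≤d : n ≤ n * m
        n≤d = ℕ.m≤m*n n m

      abstract
        g⁻¹ : K
        g⁻¹ = proj₁ (inverse g g≢0)

        g⊛g⁻¹ : g ⊛ g⁻¹ ≡ 1ₖ
        g⊛g⁻¹ = proj₂ (inverse g g≢0)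

      γ : K
      γ = θ^ n ⊛ g⁻¹

      γ⊛g : γ ⊛ g ≡ θ^ n
      γ⊛g = trans (⊛-assoc (θ^ n) g⁻¹ g)
        (trans (cong (θ^ n ⊛_) (trans (⊛-comm g⁻¹ g) g⊛g⁻¹)) (⊛-identityʳ (θ^ n)))

      γ≢0 : γ ≢ 0ᵥ
      γ≢0 eq = θ^n≢0 (trans (sym γ⊛g) (trans (cong (_⊛ g) eq) (⊛-zeroˡ g)))

      -- Division by g is possible: for v = g w one has γ v = θⁿ w, and the recurrence at w gives
      -- the claim.
      s-γ : ∀ v → s (op γ v) ≡ comb (s v) A
      s-γ v = begin
        s (op γ v)                          ≡⟨ cong (s ∘ op γ) v≡gw ⟩
        s (op γ (op g w))                   ≡⟨ cong s (op-⊛ γ g w) ⟨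
        s (op (γ ⊛ g) w)                    ≡⟨ cong (λ u → s (op u w)) γ⊛g ⟩
        s (op (θ^ n) w)                     ≡⟨ cong s (op-iter n w) ⟩
        s (iter T n w)                      ≡⟨ s-recurrence c A w ⟩
        comb (s (act T (toList c) w)) A     ≡⟨ cong (λ x → comb (s x) A) (trans v≡gw (op-reduce (toList c) w)) ⟨
        comb (s v) A                        ∎
        where
        open ≡-Reasoning
        w = op g⁻¹ v
        v≡gw : v ≡ op g w
        v≡gw = sym (trans (sym (op-⊛ g g⁻¹ v)) (trans (cong (λ u → op u v) g⊛g⁻¹) (op-1 v)))

      s-at : ∀ p v → s (op (p at γ) v) ≡ act (rowAct A) p (s v)
      s-at p v = trans (cong s (op-at γ p v)) (act-intertwine s-⊞ s-γ p v)

      -- All first blocks in the orbit of p(γ) v are values of p(A), hence zero. So p(γ) kills a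
      -- nonzero vector v.
      at-γ-zero : ∀ p → (∀ v → act (rowAct A) p v ≡ 0ᵥ) → p at γ ≡ 0ᵥ
      at-γ-zero p p-A = op-faithful (T-⊞ c A) f-T (p at γ) (true ∷ 0ᵥ) (λ ())
        (s-faithful c A _ λ i → trans (cong s (sym (act-iter (T-⊞ c A) (toList (p at γ)) i (true ∷ 0ᵥ))))
          (trans (s-at p (iter T i (true ∷ 0ᵥ))) (p-A _)))

      zero-at-γ : ∀ p → p at γ ≡ 0ᵥ → ∀ v → act (rowAct A) p v ≡ 0ᵥ
      zero-at-γ p eq v = begin
        act (rowAct A) p v        ≡⟨ cong (act (rowAct A) p) (block-glue (λ _ → v) zero) ⟨
        act (rowAct A) p (s w)    ≡⟨ s-at p w ⟨
        s (op (p at γ) w)         ≡⟨ cong (λ u → s (op u w)) eq ⟩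
        s (op 0ᵥ w)               ≡⟨ cong s (additive-0 (op-additiveˡ w)) ⟩
        s 0ᵥ                      ≡⟨ additive-0 {T = s} s-⊞ ⟩
        0ᵥ                        ∎
        where
        open ≡-Reasoning
        w = glue λ _ → v

      -- `Q` is Xⁿ + γ g. Its n + 1 coefficients are fixed by `frob N` and it has the root θ; being
      -- monic it is not zero, so θ has a period iN with 1 ≤ i ≤ n. Every positive period of θ is at
      -- least nm.
      γ-period-≥ : ∀ N → 1 ≤ N → frob N γ ≡ γ → m ≤ N
      γ-period-≥ N 1≤N fixed = Sum.[ bound , (λ zs → contradiction (All.∷ʳ⁻ zs) λ { (_ , ()) }) ]′
        (conjugates N Q θ (All.++⁺ (fixed-embed N γ fixed (toList c)) (frob-1 N ∷ [])) root)
        where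
        Q = embed γ (toList c) ∷ʳ 1ₖ
        length-embed : length (embed γ (toList c)) ≡ n
        length-embed = trans (length-map (_· γ) (toList c)) (length-toList c)
        root : eval Q θ ≡ 0ᵥ
        root = trans (eval-θ-∷ʳ (embed γ (toList c)) 1ₖ) (≡⇒⊞≡0 (begin
          eval (embed γ (toList c)) θ                 ≡⟨ eval-embed γ (toList c) θ ⟩
          γ ⊛ toList c at θ                           ≡⟨ cong (γ ⊛_) (at-θ (toList c)) ⟩
          γ ⊛ g                                       ≡⟨ γ⊛g ⟩
          θ^ n                                        ≡⟨ cong θ^ length-embed ⟨
          iter S (length (embed γ (toList c))) 1ₖ     ∎))
          where open ≡-Reasoning
        bound : (∃ λ i → 1 ≤ i × i < length Q × frob (i * N) θ ≡ θ) → m ≤ N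
        bound (i , 1≤i , i<l , eq) = ℕ.*-cancelˡ-≤ n
          (≤-trans (frob-θ-order (i * N) (ℕ.*-mono-≤ 1≤i 1≤N) eq) (ℕ.*-monoˡ-≤ N i≤n))
          where
          i≤n : i ≤ n
          i≤n = ℕ.≤-pred (≤-trans i<l (≤-reflexive (trans (length-++ (embed γ (toList c)))
            (trans (cong (_+ 1) length-embed) (ℕ.+-comm n 1)))))

      -- `conjugates` for Frobenius itself, N = 1, combined with the lower bound on the period of γ.
      root-conjugates : ∀ p → p at γ ≡ 0ᵥ → (∃ λ i → m ≤ i × i < length p × frob i γ ≡ γ) ⊎ Zero (embed 1ₖ p)
      root-conjugates p eq with conjugates 1 (embed 1ₖ p) γ (fixed-embed 1 1ₖ (frob-1 1) p)
        (trans (eval-embed 1ₖ p γ) (trans (⊛-identityˡ _) eq))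
      ... | inj₂ zs = inj₂ zs
      ... | inj₁ (i , 1≤i , i<l , fixed) = inj₁ (i , γ-period-≥ i 1≤i fixed′ ,
        ≤-trans i<l (≤-reflexive (length-map (_· 1ₖ) p)) , fixed′)
        where
        fixed′ : frob i γ ≡ γ
        fixed′ = trans (cong (λ k → frob k γ) (sym (ℕ.*-identityʳ i))) fixed

      γ-independent : ∀ (u : V m) → toList u at γ ≡ 0ᵥ → u ≡ 0ᵥ
      γ-independent u eq with root-conjugates (toList u) eq
      ... | inj₂ zs = zero-embed u zs
      ... | inj₁ (i , m≤i , i<l , _) = contradiction (≤-trans i<l (≤-trans (≤-reflexive (length-toList u)) m≤i)) (ℕ.<-irrefl refl)

      -- The characteristic polynomial of `A` is monic of degree m and vanishes at γ, so γ has a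
      -- positive period at most m; the lower bound makes it exactly m.
      frob-γ : frob m γ ≡ γ
      frob-γ = from-monic (charPoly-monic A)
        where
        from-monic : (∃ λ hv → charPoly A ≡ toList {n = m} hv ∷ʳ true) → frob m γ ≡ γ
        from-monic (hv , χ≡) = Sum.[ period , (λ zs → contradiction (All.∷ʳ⁻ zs) λ { (_ , ()) }) ]′
          (subst (λ p → (∃ λ i → m ≤ i × i < length h × frob i γ ≡ γ) ⊎ Zero p)
            (List.map-++ (_· 1ₖ) (toList hv) (true ∷ []))
            (root-conjugates h (at-γ-zero h λ v →
              trans (cong (λ p → act (rowAct A) p v) (sym χ≡)) (cayley-hamilton A v))))
          where
          h = toList hv ∷ʳ true
          period : (∃ λ i → m ≤ i × i < length h × frob i γ ≡ γ) → frob m γ ≡ γ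
          period (i , m≤i , i<l , fixed) = subst (λ k → frob k γ ≡ γ) (ℕ.≤-antisym i≤m m≤i) fixed
            where
            i≤m : i ≤ m
            i≤m = ℕ.≤-pred (≤-trans i<l (≤-reflexive (trans (length-++ (toList hv))
              (trans (cong (_+ 1) (length-toList hv)) (ℕ.+-comm m 1)))))

      module _ (hv : V m) (h-A : ∀ v → act (rowAct A) (toList hv ∷ʳ true) v ≡ 0ᵥ) where

        private module H = Companion hv

        h-γ : ∀ v → act (γ ⊛_) H.f v ≡ 0ᵥ
        h-γ v = trans (sym (at-⊛ γ H.f v)) (trans (cong (_⊛ v) (at-γ-zero H.f h-A)) (⊛-zeroˡ v))

        -- The map u ↦ u(γ) is an injective ring homomorphism from F₂[X]/(h) to the field K. So
        -- F₂[X]/(h) has no zero divisors, and by finiteness multiplication by u ≠ 0 is onto.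
        H-inverse : ∀ u → u ≢ 0ᵥ → ∃ λ w → w H.⊛ u ≡ H.1ₖ
        H-inverse u u≢0 = injective⇒surjective (H._⊛ u)
          (additive-injective (H.⊛-additiveˡ u) λ w eq → γ-independent w (op-ker S-⊞ f-S (toList u at γ)
            (u≢0 ∘ γ-independent u) (toList w at γ) (trans (⊛-comm (toList u at γ) (toList w at γ)) (vanishes w eq))))
          H.1ₖ
          where
          open ≡-Reasoning
          vanishes : ∀ w → w H.⊛ u ≡ 0ᵥ → toList w at γ ⊛ toList u at γ ≡ 0ᵥ
          vanishes w eq = begin
            toList w at γ ⊛ toList u at γ                        ≡⟨ at-mulRaw γ (toList w) (toList u) ⟨
            mulRaw (toList w) (toList u) at γ                    ≡⟨ H.act-reduce (⊛-additiveʳ γ) 1ₖ (h-γ 1ₖ) (mulRaw (toList w) (toList u)) ⟨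
            toList (H.reduce (mulRaw (toList w) (toList u))) at γ ≡⟨ cong (λ x → toList x at γ) (trans (H.reduce-mulRaw (toList w) (toList u))
                                                                    (trans (cong₂ H._⊛_ (H.reduce-toList w) (H.reduce-toList u)) eq)) ⟩
            toList (0ᵥ {m}) at γ                                 ≡⟨ trans (sym (comb-orbit (⊛-additiveʳ γ) (0ᵥ {m}) 1ₖ)) (comb-0 (orbit (γ ⊛_) 1ₖ m)) ⟩
            0ᵥ                                                   ∎

        -- h(B) = 0 makes F₂ᵐ a module over the field F₂[X]/(h). If u were nonzero, its inverse
        -- applied to u(B) v = 0 would give v = 0.
        cyclic : ∀ (B : Mat Bool m) → (∀ v → act (rowAct B) H.f v ≡ 0ᵥ) → ∀ v → v ≢ 0ᵥ →
                 ∀ u → act (rowAct B) (toList u) v ≡ 0ᵥ → u ≡ 0ᵥ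
        cyclic B h-B v v≢0 u eq = decidable-stable (u ≟ᵥ 0ᵥ) λ u≢0 → v≢0 (killed (H-inverse u u≢0))
          where
          open ≡-Reasoning
          module HB = H.Module (comb-additive B) h-B
          killed : (∃ λ w → w H.⊛ u ≡ H.1ₖ) → v ≡ 0ᵥ
          killed (w , wu≡1) = begin
            v                    ≡⟨ HB.op-1 v ⟨
            HB.op H.1ₖ v         ≡⟨ cong (λ x → HB.op x v) wu≡1 ⟨
            HB.op (w H.⊛ u) v    ≡⟨ HB.op-⊛ w u v ⟩
            HB.op w (HB.op u v)  ≡⟨ cong (HB.op w) eq ⟩
            HB.op w 0ᵥ           ≡⟨ additive-0 (HB.op-additiveʳ w) ⟩
            0ᵥ                   ∎

        -- `A` and `B` are both similar to the companion matrix `toMat H.S` of h, by u ↦ e₁ u(A) and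
        -- u ↦ e₁ u(B). Hence f(T) = 0 passes from `A` back to the companion matrix and from there
        -- to `B`.
        same-f : ∀ (B : Mat Bool m) → (∀ v → act (rowAct B) H.f v ≡ 0ᵥ) → ∀ v → act T⟨ c , B ⟩ f v ≡ 0ᵥ
        same-f B h-B = annihilates-image (φ-⊞ B) (φ-comm B h-B) c f
          (injective⇒surjective (φ B) (additive-injective (φ-⊞ B) (cyclic B h-B e₁ (λ ()))))
          (annihilates-preimage (φ-⊞ A) (φ-comm A h-A) c f (cyclic A h-A e₁ (λ ())) f-T)
          where
          e₁ : V m
          e₁ = true ∷ 0ᵥ
          φ : Mat Bool m → V m → V m
          φ B u = act (rowAct B) (toList u) e₁
          φ-⊞ : ∀ B → Additive (φ B)
          φ-⊞ B u w = act-toList-⊞ (comb-additive B) u w e₁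
          φ-comm : ∀ B → (∀ v → act (rowAct B) H.f v ≡ 0ᵥ) → ∀ u → φ B (comb u (toMat H.S)) ≡ comb (φ B u) B
          φ-comm B h-B u = trans (cong (φ B) (comb-toMat H.S-⊞ u)) (H.act-S (comb-additive B) e₁ (h-B e₁) u)

    module Compare (c c′ : V n) (A A′ : Mat Bool m)
                   (f-T : ∀ v → act T⟨ c , A ⟩ f v ≡ 0ᵥ) (f-T′ : ∀ v → act T⟨ c′ , A′ ⟩ f v ≡ 0ᵥ) where

      private
        module L = ForT c A f-T
        module R = ForT c′ A′ f-T′

        difference : ∀ {k} → V k → V k → List K
        difference a b = toList (zipWith (λ x y → x · L.γ ⊞ y · R.γ) a b)

        length-difference : ∀ {k} (a b : V k) → length (difference a b) ≡ k
        length-difference a b = length-toList (zipWith (λ x y → x · L.γ ⊞ y · R.γ) a b)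

        eval-difference : ∀ {k} (a b : V k) x →
                          eval (difference a b) x ≡ eval (embed L.γ (toList a)) x ⊞ eval (embed R.γ (toList b)) x
        eval-difference [] [] x = sym (⊞-self 0ᵥ)
        eval-difference (a ∷ u) (b ∷ w) x = trans
          (cong (a · L.γ ⊞ b · R.γ ⊞_) (trans (cong (x ⊛_) (eval-difference u w x)) (⊛-additiveʳ x _ _)))
          (medial _ _ _ _)

        fixed-difference : ∀ {k} (a b : V k) → All (λ x → frob m x ≡ x) (difference a b)
        fixed-difference [] [] = []
        fixed-difference (a ∷ u) (b ∷ w) = trans (frob-⊞ m _ _) (cong₂ _⊞_
            (trans (additive-· (frob-⊞ m) a L.γ) (cong (a ·_) L.frob-γ))
            (trans (additive-· (frob-⊞ m) b R.γ) (cong (b ·_) R.frob-γ)))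
          ∷ fixed-difference u w

        root : eval (difference c c′) θ ≡ 0ᵥ
        root = trans (eval-difference c c′ θ) (≡⇒⊞≡0 (trans
          (trans (eval-embed L.γ (toList c) θ) (trans (cong (L.γ ⊛_) (at-θ (toList c))) L.γ⊛g))
          (sym (trans (eval-embed R.γ (toList c′) θ) (trans (cong (R.γ ⊛_) (at-θ (toList c′))) R.γ⊛g)))))

        zero-difference : ∀ {k} (a b : V k) → Zero (difference a b) → ∀ i → lookup a i · L.γ ≡ lookup b i · R.γ
        zero-difference (a ∷ u) (b ∷ w) (eq ∷ zs) zero = ⊞≡0⇒≡ _ _ eq
        zero-difference (a ∷ u) (b ∷ w) (eq ∷ zs) (suc i) = zero-difference u w zs i

        -- γ g + γ′ g′ has only n coefficients, as θⁿ cancels. They are fixed by `frob m`, so if one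
        -- were nonzero, the root θ would have a period im with 1 ≤ i < n, below nm.
        proportional : ∀ i → lookup c i · L.γ ≡ lookup c′ i · R.γ
        proportional = Sum.[ (λ short → contradiction short too-short) , zero-difference c c′ ]′
          (conjugates m (difference c c′) θ (fixed-difference c c′) root)
          where
          too-short : ¬ (∃ λ i → 1 ≤ i × i < length (difference c c′) × frob (i * m) θ ≡ θ)
          too-short (i , 1≤i , i<l , eq) = ℕ.<-irrefl refl
            (≤-trans i<l (≤-trans (≤-reflexive (length-difference c c′))
              (ℕ.*-cancelʳ-≤ n i m (frob-θ-order (i * m) (ℕ.*-mono-≤ 1≤i (s≤s (z≤n {suc m″}))) eq))))

      -- At an index with c_i = 1 the proportionality reads γ = c′_i γ′, and c′_i = 0 is impossible
      -- because γ ≠ 0.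
      γ≡γ′ : L.γ ≡ R.γ
      γ≡γ′ = at-entry (nonzero-entry c L.c≢0)
        where
        scalar : ∀ b → L.γ ≡ b · R.γ → L.γ ≡ R.γ
        scalar true eq = eq
        scalar false eq = contradiction eq L.γ≢0
        at-entry : (∃ λ i → lookup c i ≡ true) → L.γ ≡ R.γ
        at-entry (i , cᵢ) = scalar (lookup c′ i) (trans (cong (_· L.γ) (sym cᵢ)) (proportional i))

      c≡c′ : c ≡ c′
      c≡c′ = lookup-ext λ i → ·-cancelʳ (lookup c i) (lookup c′ i) L.γ≢0
        (trans (proportional i) (cong (lookup c′ i ·_) (sym γ≡γ′)))

      -- For either matrix the annihilating polynomials are those vanishing at the common γ.
      same-annihilators : ∀ p → (∀ v → act (rowAct A) p v ≡ 0ᵥ) → ∀ v → act (rowAct A′) p v ≡ 0ᵥ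
      same-annihilators p p-A = R.zero-at-γ p (trans (cong (p at_) (sym γ≡γ′)) (L.at-γ-zero p p-A))

-- Counting the fibres

e₁ : ∀ {k} → V (suc k)
e₁ = true ∷ 0ᵥ

extends-e₁⇒independent : ∀ {k} (cs : Vec (V (suc k)) k) → Extends (e₁ ∷ []) cs → Independent (e₁ ∷ cs)
extends-e₁⇒independent cs ext (a ∷ u) eq with ext u (a ∷ [])
  (trans (cong (comb u cs ⊞_) (⊞-identityʳ (a · e₁))) (trans (⊞-comm (comb u cs) (a · e₁)) eq))
... | refl , refl = refl

independent⇒extends-e₁ : ∀ {k} (cs : Vec (V (suc k)) k) → Independent (e₁ ∷ cs) → Extends (e₁ ∷ []) cs
independent⇒extends-e₁ cs ind u (a ∷ []) eq with ind (a ∷ u)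
  (trans (⊞-comm (a · e₁) (comb u cs)) (trans (cong (comb u cs ⊞_) (sym (⊞-identityʳ (a · e₁)))) eq))
... | refl = refl , refl

independent-e₁ : ∀ {k} → Independent (e₁ {k} ∷ [])
independent-e₁ (true ∷ []) ()
independent-e₁ (false ∷ []) eq = refl

-- The matrix acting in the basis b as multiplication by X acts modulo h.
module BasisMatrix {k : ℕ} (hv : V (suc k)) (b : Vec (V (suc k)) (suc k)) (ind : Independent b) where

  open Companion hv

  coordinates : ∀ v → ∃ λ u → comb u b ≡ v
  coordinates = injective⇒surjective (λ u → comb u b) (additive-injective (comb-additive b) ind)

  step : V (suc k) → V (suc k)
  step v = comb (S (proj₁ (coordinates v))) b

  step-comb : ∀ u → step (comb u b) ≡ comb (S u) b
  step-comb u = cong (λ w → comb (S w) b)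
    (additive-injective (comb-additive b) ind {proj₁ (coordinates (comb u b))} {u} (proj₂ (coordinates (comb u b))))

  step-⊞ : Additive step
  step-⊞ v w = begin
    step (v ⊞ w)                           ≡⟨ cong₂ (λ x y → step (x ⊞ y)) (proj₂ (coordinates v)) (proj₂ (coordinates w)) ⟨
    step (comb v′ b ⊞ comb w′ b)           ≡⟨ cong step (comb-⊞ v′ w′ b) ⟨
    step (comb (v′ ⊞ w′) b)                ≡⟨ step-comb (v′ ⊞ w′) ⟩
    comb (S (v′ ⊞ w′)) b                   ≡⟨ cong (λ x → comb x b) (S-⊞ v′ w′) ⟩
    comb (S v′ ⊞ S w′) b                   ≡⟨ comb-⊞ (S v′) (S w′) b ⟩
    step v ⊞ step w                        ∎
    where
    open ≡-Reasoning
    v′ = proj₁ (coordinates v)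
    w′ = proj₁ (coordinates w)

  matrix : Mat Bool (suc k)
  matrix = toMat step

  matrix-comb : ∀ u → comb (comb u b) matrix ≡ comb (S u) b
  matrix-comb u = trans (comb-toMat step-⊞ (comb u b)) (step-comb u)

  act-matrix : ∀ p u → act (rowAct matrix) p (comb u b) ≡ comb (act S p u) b
  act-matrix p u = sym (act-intertwine (comb-additive b) (λ u → sym (matrix-comb u)) p u)

  f-matrix : ∀ v → act (rowAct matrix) f v ≡ 0ᵥ
  f-matrix v = begin
    act (rowAct matrix) f v            ≡⟨ cong (act (rowAct matrix) f) (proj₂ (coordinates v)) ⟨
    act (rowAct matrix) f (comb u b)   ≡⟨ act-matrix f u ⟩
    comb (act S f u) b                 ≡⟨ cong (λ x → comb x b) (f-S u) ⟩
    comb 0ᵥ b                          ≡⟨ comb-0 b ⟩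
    0ᵥ                                 ∎
    where
    open ≡-Reasoning
    u = proj₁ (coordinates v)

module Fibre (n′ m″ : ℕ) where

  open Situation n′ m″
  open FirstBlock n′ m

  module _ (fv : V (n * m)) (prim : Primitive (n * m) (toList fv ∷ʳ true))
           (c : V n) (A : Mat Bool m)
           (f-T : ∀ v → act T⟨ c , A ⟩ (toList fv ∷ʳ true) v ≡ 0ᵥ)
           (hv : V m) (h-A : ∀ v → act (rowAct A) (toList hv ∷ʳ true) v ≡ 0ᵥ) where

    private
      f h : Poly
      f = toList fv ∷ʳ true
      h = toList hv ∷ʳ true
      open Fixed fv (proj₂ (proj₂ (proj₂ prim))) using (charPoly-unique; module ForT; module Compare)
      open ForT c A f-T using (c≢0; cyclic; same-f)
      module H = Companion hv

      Fib : Mat Bool (n * m) → Set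
      Fib T = TSRP m n T × charPoly T ≡ f

      -- B has minimal polynomial h, T is the TSR matrix of (c , B), and e₁, cs are e₁, e₁B, e₁B², ….
      Rel : Vec (V m) (suc m″) → Mat Bool (n * m) → Set
      Rel cs T = ∃ λ B → (∀ v → act (rowAct B) h v ≡ 0ᵥ) × T ≡ tsr m n c B ×
                 (∀ u → comb u (e₁ ∷ cs) ≡ act (rowAct B) (toList u) e₁)

      basis⇒matrix : ∀ cs → Extends (e₁ ∷ []) cs → ∃ λ T → Fib T × Rel cs T
      basis⇒matrix cs ext = tsr m n c B , (((c , B , refl) , subst (Primitive (n * m)) (sym χ) prim) , χ) ,
        -- e₁ is the basis vector with coordinates `1ₖ`, so u(B) e₁ has coordinates u.
        (B , h-B , refl , λ u → sym (trans (cong (act (rowAct B) (toList u)) (sym (comb-unit zero (e₁ ∷ cs))))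
          (trans (M.act-matrix (toList u) H.1ₖ) (cong (λ x → comb x (e₁ ∷ cs)) (H.reduce-toList u)))))
        where
        module M = BasisMatrix hv (e₁ ∷ cs) (extends-e₁⇒independent cs ext)
        B = M.matrix
        h-B = M.f-matrix
        χ : charPoly (tsr m n c B) ≡ f
        χ = charPoly-unique (tsr m n c B) (same-f hv h-A B h-B)

      -- A member of the fibre comes with its own `c′` and `A′`. The comparison turns `c′` into `c`
      -- and gives h(A′) = 0, which makes e₁ a cyclic vector of `A′`.
      matrix⇒basis : ∀ T → Fib T → ∃ λ cs → Extends (e₁ ∷ []) cs × Rel cs T
      matrix⇒basis T (((c′ , A′ , refl) , _) , χ) = cs , independent⇒extends-e₁ cs independent ,
        (A′ , h-A′ , cong (λ x → tsr m n x A′) (sym (Compare.c≡c′ c c′ A A′ f-T f-T′)) , span)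
        where
        f-T′ : ∀ v → act T⟨ c′ , A′ ⟩ f v ≡ 0ᵥ
        f-T′ v = trans (cong (λ p → act T⟨ c′ , A′ ⟩ p v) (sym χ)) (cayley-hamilton (tsr m n c′ A′) v)
        h-A′ : ∀ v → act (rowAct A′) h v ≡ 0ᵥ
        h-A′ = Compare.same-annihilators c c′ A A′ f-T f-T′ h h-A
        cs : Vec (V m) (suc m″)
        cs = orbit (rowAct A′) (rowAct A′ e₁) (suc m″)
        span : ∀ u → comb u (e₁ ∷ cs) ≡ act (rowAct A′) (toList u) e₁
        span u = comb-orbit (comb-additive A′) u e₁
        independent : Independent (e₁ ∷ cs)
        independent u eq = cyclic hv h-A A′ h-A′ e₁ (λ ()) u (trans (sym (span u)) eq)

      -- As c ≠ 0, `T` determines `B`, and `B` determines the orbit of e₁.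
      Rel-injective : ∀ {cs cs′ T} → Rel cs T → Rel cs′ T → cs ≡ cs′
      Rel-injective {cs} {cs′} (B , h-B , T≡ , span) (B′ , h-B′ , T≡′ , span′) =
        cong Vec.tail (comb-injective (e₁ ∷ cs) (e₁ ∷ cs′) λ u →
          trans (span u) (trans (cong (λ M → act (rowAct M) (toList u) e₁) B≡B′) (sym (span′ u))))
        where
        B≡B′ : B ≡ B′
        B≡B′ = tsr-injective c (proj₂ (nonzero-entry c c≢0)) (trans (sym T≡) T≡′)

      -- In the basis e₁, `cs` the matrix must act as multiplication by X modulo h, so the basis
      -- determines it.
      Rel-functional : ∀ {cs T T′} → Rel cs T → Rel cs T′ → T ≡ T′
      Rel-functional {cs} (B , h-B , T≡ , span) (B′ , h-B′ , T≡′ , span′) =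
        trans T≡ (trans (cong (tsr m n c) (comb-injective B B′ same)) (sym T≡′))
        where
        step : ∀ B → (∀ v → act (rowAct B) h v ≡ 0ᵥ) → (∀ u → comb u (e₁ ∷ cs) ≡ act (rowAct B) (toList u) e₁) →
               ∀ u → comb (comb u (e₁ ∷ cs)) B ≡ comb (H.S u) (e₁ ∷ cs)
        step B h-B span u = trans (cong (rowAct B) (span u))
          (trans (sym (H.act-S (comb-additive B) e₁ (h-B e₁) u)) (sym (span (H.S u))))
        independent : Independent (e₁ ∷ cs)
        independent u eq = cyclic hv h-A B h-B e₁ (λ ()) u (trans (sym (span u)) eq)
        same : ∀ v → comb v B ≡ comb v B′
        same v = trans (cong (λ x → comb x B) (sym u≡v)) (trans (step B h-B span u)
          (trans (sym (step B′ h-B′ span′ u)) (cong (λ x → comb x B′) u≡v)))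
          where
          u = proj₁ (BasisMatrix.coordinates hv (e₁ ∷ cs) independent v)
          u≡v = proj₂ (BasisMatrix.coordinates hv (e₁ ∷ cs) independent v)

    card-fibre-charPoly : HasCard (λ T → TSRP m n T × charPoly T ≡ f) (prodGL m)
    card-fibre-charPoly = card-rel Rel basis⇒matrix matrix⇒basis Rel-injective Rel-functional
      (subst (HasCard (Extends (e₁ ∷ []))) (extensions≡prodGL (suc m″))
        (card-extensions (suc m″) (e₁ ∷ []) independent-e₁))

  -- The witness that f lies in the image supplies the reference pair `c`, `A` for the whole fibre,
  -- and h is the characteristic polynomial of that `A`.
  card-TSRP-fibre : ∀ f → PsiTSRP m n f → HasCard (λ T → TSRP m n T × charPoly T ≡ f) (prodGL m)
  card-TSRP-fibre f (T , ((c , A , refl) , prim) , χ) =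
    from-monic (charPoly-monic (tsr m n c A)) (charPoly-monic A)
    where
    from-monic : (∃ λ fv → charPoly (tsr m n c A) ≡ toList {n = n * m} fv ∷ʳ true) →
                 (∃ λ hv → charPoly A ≡ toList {n = m} hv ∷ʳ true) →
                 HasCard (λ T → TSRP m n T × charPoly T ≡ f) (prodGL m)
    from-monic (fv , χ≡fv) (hv , χ≡hv) =
      subst (λ p → HasCard (λ T → TSRP m n T × charPoly T ≡ p) (prodGL m)) (trans (sym χ≡fv) χ)
        (card-fibre-charPoly fv (subst (Primitive (n * m)) χ≡fv prim) c A
          (subst (λ p → ∀ v → act T⟨ c , A ⟩ p v ≡ 0ᵥ) χ≡fv (cayley-hamilton (tsr m n c A)))
          hv (subst (λ p → ∀ v → act (rowAct A) p v ≡ 0ᵥ) χ≡hv (cayley-hamilton A)))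

theorem3p4 : (m n : ℕ) → 2 ≤ m → 1 ≤ n →
    (N M : ℕ) → HasCard (TSRP m n) N → HasCard (PsiTSRP m n) M →
    N ≡ M * prodGL m
theorem3p4 (suc (suc m″)) (suc n′) (s≤s (s≤s _)) (s≤s _) N M cardT cardΨ =
  -- The matrices are fibred by `charPoly` over the set counted by `cardΨ`; uniqueness of
  -- cardinality identifies `N` with the resulting product.
  card-unique cardT (card-fibre charPoly (λ T tsrp → T , tsrp , refl) cardΨ (Fibre.card-TSRP-fibre n′ m″))
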